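{- Let $n\ge 0$ and let $(\alpha,\beta)$ be an instance, i.e. nonnegative reals $\alpha_0,\dots,\alpha_n$ and $\beta_1,\dots,\beta_n$ with $\sum_{i=0}^n\alpha_i+\sum_{k=1}^n\beta_k=1$. For every two-way comparison search tree without non-key locations (a $2\mathrm{WCST}_{\mathrm{nil}}$) $T^\ast$ for $(\alpha,\beta)$, there exists a two-way comparison search tree with non-key locations (a $2\mathrm{WCST}_{\mathrm{loc}}$) $T'$ for $(\alpha,\beta)$ such that $\mathrm{cost}(T')\le \mathrm{cost}(T^\ast)+1$.
   Context: The set of keys is $K=\{1,2,\dots,n\}$ and every query $q$ lies in the open interval $U=(0,n+1)$. The instance $(\alpha,\beta)$ specifies a query distribution: for each key $k\in K$ the probability that $q=k$ is $\beta_k$, and for each $i\in\{0,1,\dots,n\}$ the probability that $q\in(i,i+1)$ is $\alpha_i$. A two-way comparison search tree is a finite rooted binary tree in which each internal node is a comparison node of one of two types: an equality test "$q=k$" or an inequality test "$q<k$", for some key $k\in K$. Each comparison node has a left child (followed when the answer is "yes") and a right child (followed when the answer is "no"). A search for a query $q\in U$ starts at the root and follows comparisons until it reaches a leaf. In a $2\mathrm{WCST}_{\mathrm{loc}}$, each leaf is labelled either by a key $k\in K$ (representing the set $\{k\}$) or by an open interval $(i,i+1)$ with $i\in\{0,\dots,n\}$. It is correct if every query $q\in U$ reaches a leaf whose label contains $q$ (so a search must identify the inter-key interval of any non-key query). In a $2\mathrm{WCST}_{\mathrm{nil}}$, each leaf is labelled either by a key $k\in K$ or by a special symbol $\bot$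 meaning "not a key". It is correct if every query $q=k\in K$ reaches a leaf labelled $k$, and every query $q\in U\setminus K$ reaches a leaf labelled $\bot$. Several leaves may be labelled $\bot$. In both models, a tree may be redundant (several leaves may share a label, or some node may be reached by no query). For a tree $T$ and a query $q$, $\mathrm{depth}_T(q)$ is the number of comparisons performed in the search for $q$ in $T$. All queries in the same open interval $(i,i+1)$ follow the same path, so $\mathrm{depth}_T((i,i+1))$ is well-defined. The cost is the expected query depth: $$\mathrm{cost}(T)=\sum_{k=1}^n\beta_k\,\mathrm{depth}_T(k)+\sum_{i=0}^n\alpha_i\,\mathrm{depth}_T((i,i+1)).$$
   Formalization: The probabilities α_0,…,α_n and β_1,…,β_n are taken to be nonnegative rationals summing to 1 instead of nonnegative reals. -}

module Defs where

open import Data.Nat using (ℕ; zero; suc)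
import Data.Nat as ℕ
open import Data.Fin using (Fin; toℕ)
open import Data.Maybe using (Maybe; just; nothing)
open import Data.Bool using (Bool; true; false; if_then_else_)
open import Data.Rational using (ℚ; 0ℚ; 1ℚ; _+_; _*_; _/_)
open import Data.Integer using (+_)
open import Relation.Nullary.Decidable using (⌊_⌋)
open import Relation.Binary.PropositionalEquality using (_≡_)
import Data.Fin as F

-- Keys K = {1,…,n}: the key with index i : Fin n is the number toℕ i + 1.
-- Inter-key intervals: index i : Fin (suc n) stands for the open interval (i, i+1).

-- A query class: either a key, or (any point of) an open inter-key interval.
data Query (n : ℕ) : Set where
  key : Fin n → Query n
  gap : Fin (suc n) → Query n

data Cmp : Set where
  eqT : Cmp
  ltT : Cmp

-- Two-way comparison search trees over keys Fin n with leaf labels in L.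
-- node c k yes no : compare q with key k; go to yes-subtree if the answer is yes.
data Tree (n : ℕ) (L : Set) : Set where
  leaf : L → Tree n L
  node : Cmp → Fin n → Tree n L → Tree n L → Tree n L

answer : ∀ {n} → Cmp → Fin n → Query n → Bool
answer eqT k (key i) = ⌊ i F.≟ k ⌋
answer eqT k (gap i) = false
-- key (i+1) < key (k+1)  iff  i < k
answer ltT k (key i) = ⌊ toℕ i ℕ.<? toℕ k ⌋
-- every point of (i, i+1) is < k+1  iff  i+1 ≤ k+1  iff  i ≤ k
answer ltT k (gap i) = ⌊ toℕ i ℕ.≤? toℕ k ⌋

search : ∀ {n L} → Tree n L → Query n → L
search (leaf l) q = l
search (node c k t u) q = if answer c k q then search t q else search u q

depth : ∀ {n L} → Tree n L → Query n → ℕ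
depth (leaf l) q = 0
depth (node c k t u) q = suc (if answer c k q then depth t q else depth u q)

Tree-loc : ℕ → Set
Tree-loc n = Tree n (Query n)

Correct-loc : ∀ {n} → Tree-loc n → Set
Correct-loc {n} T = (q : Query n) → search T q ≡ q

Tree-nil : ℕ → Set
Tree-nil n = Tree n (Maybe (Fin n))

nilLabel : ∀ {n} → Query n → Maybe (Fin n)
nilLabel (key k) = just k
nilLabel (gap i) = nothing

Correct-nil : ∀ {n} → Tree-nil n → Set
Correct-nil {n} T = (q : Query n) → search T q ≡ nilLabel q

Σℚ : ∀ {m} → (Fin m → ℚ) → ℚ
Σℚ {zero} f = 0ℚ
Σℚ {suc m} f = f F.zero + Σℚ (λ i → f (F.suc i))

ℕ→ℚ : ℕ → ℚ
ℕ→ℚ k = (+ k) / 1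

-- Instance weights: α i = Pr[q ∈ (i,i+1)], β k = Pr[q = k].
-- cost(T) = Σ_k β_k depth_T(k) + Σ_i α_i depth_T((i,i+1)).
cost : ∀ {n L} → (α : Fin (suc n) → ℚ) → (β : Fin n → ℚ) → Tree n L → ℚ
cost α β T = Σℚ (λ k → β k * ℕ→ℚ (depth T (key k)))
           + Σℚ (λ i → α i * ℕ→ℚ (depth T (gap i)))

IsInstance : ∀ {n} → (Fin (suc n) → ℚ) → (Fin n → ℚ) → Set
IsInstance {n} α β =
  ((i : Fin (suc n)) → 0ℚ Data.Rational.≤ α i) ×' ((k : Fin n) → 0ℚ Data.Rational.≤ β k) ×' (Σℚ α + Σℚ β ≡ 1ℚ)
  where open import Data.Product renaming (_×_ to _×'_)

{-# OPTIONS --safe #-}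
-- Key j and the gap above it form brick j (brick 0 is a gap only): only the test "q = j" separates the two, so it
-- lies on the path to gap j, and a subtree serves an interval of bricks from which the keys tested above are missing.
-- The tree is converted top-down, with budget for a subtree its cost plus the weight of the queries reaching it; in
-- that cost a ⊥-leaf also pays its weight once for each cut that must still be made at a key tested above.
-- Turning "q = k" into a cut at c, "q < c", restricts the subtree to both sides; on either side the tests that c
-- decides disappear, and k itself may become one level deeper, which its own weight pays for.
--  * If the next test lies left of k, cut at k: the left side saves "q = k", the right side saves the next test.
--  * If the next test lies right of k, cut at k + 1. The cut at k that remains to be made is paid by a second
--    test right of k on the path to gap k, or by the leaf itself if the path has no further test.
--  * Otherwise all later tests on that path lie left of k. If the next test is "q = k₂", cut at k and finish the right
--    side directly. If it is "q < d", then of the weights of k, of the side cut off by d and of the leaf at gap k,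
--    either the first is at most the second (cut at d), or the third is at most the first (keep "q = k" and let k pay
--    for its cut at the leaf), or the second is at most the third (cut at k, the leaf pays for the other side).
module Submission where

open import Defs
open import Data.Nat using (ℕ; suc)
open import Data.Fin using (Fin)
open import Data.Product using (Σ; _×_)
open import Data.Rational using (ℚ; _≤_; _+_; 1ℚ)
open import Data.Bool using (Bool; true; false; if_then_else_)
open import Data.Empty using (⊥)
open import Data.Fin using (toℕ; fromℕ<)
import Data.Fin as Fin
open import Data.Fin.Properties using (toℕ-fromℕ<; toℕ<n; toℕ-injective)
import Data.Integer as ℤ
import Data.Integer.Properties as ℤₚ
open import Data.Maybe using (just)
open import Data.Nat using (zero; _≡ᵇ_; s≤s; z≤n; z<s; s<s) renaming (_≤_ to _≤ⁿ_; _<_ to _<ⁿ_; _+_ to _+ⁿ_)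
import Data.Nat as ℕ
import Data.Nat.Coprimality as Coprimality
import Data.Nat.Properties as ℕₚ
open import Data.Product using (_,_; proj₁; proj₂; ∃)
open import Data.Rational using (0ℚ; _-_; -_; _*_)
import Data.Rational as ℚ
open import Data.Rational.Properties
open import Data.Rational.Solver using (module +-*-Solver)
open import Data.Sum using (_⊎_; inj₁; inj₂; [_,_]′)
open import Function using (const; _∘_)
open import Relation.Binary.PropositionalEquality using (_≡_; _≢_; refl; sym; trans; cong; cong₂; subst; module ≡-Reasoning)
open import Relation.Nullary using (¬_; Dec; contradiction; yes; no)
open import Relation.Nullary.Decidable using (⌊_⌋; isYes≗does; dec-true; dec-false)
open +-*-Solver using (Polynomial; con; solve; _:+_; _:-_; _:=_)

-- Linear arithmetic and sums over ranges

con0 : ∀ {n} → Polynomial n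
con0 = con 0ℚ

-- Linear arithmetic: a linear combination of hypotheses l ≤ r proves a ≤ b once a + r ≡ b + l.
linear : ∀ {l r a b} → l ≤ r → a + r ≡ b + l → a ≤ b
linear {l} {r} {a} {b} l≤r eq = begin
  a             ≡⟨ solve 2 (λ x y → x := (x :+ y) :- y) refl a r ⟩
  (a + r) - r   ≡⟨ cong (_- r) eq ⟩
  (b + l) - r   ≤⟨ +-monoˡ-≤ (- r) (+-monoʳ-≤ b l≤r) ⟩
  (b + r) - r   ≡⟨ solve 2 (λ x y → (x :+ y) :- y := x) refl b r ⟩
  b             ∎
  where open ≤-Reasoning

infixl 6 _⊹_
_⊹_ : ∀ {p q r s} → p ≤ q → r ≤ s → p + r ≤ q + s
_⊹_ = +-mono-≤

prefix : (ℕ → ℚ) → ℕ → ℚ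
prefix f zero    = 0ℚ
prefix f (suc n) = prefix f n + f n

-- The sum of f over lo ≤ j < hi; as a difference it is additive in the range without side conditions.
sum : (ℕ → ℚ) → ℕ → ℕ → ℚ
sum f lo hi = prefix f hi - prefix f lo

sum-split : ∀ f lo c hi → sum f lo c + sum f c hi ≡ sum f lo hi
sum-split f lo c hi = solve 3 (λ x y z → (y :- x) :+ (z :- y) := z :- x) refl (prefix f lo) (prefix f c) (prefix f hi)

sum-empty : ∀ f k → sum f k k ≡ 0ℚ
sum-empty f k = +-inverseʳ (prefix f k)

sum-snoc : ∀ f lo k → sum f lo (suc k) ≡ sum f lo k + f k
sum-snoc f lo k = solve 3 (λ x y z → (x :+ y) :- z := (x :- z) :+ y) refl (prefix f k) (f k) (prefix f lo)

sum-one : ∀ f k → sum f k (suc k) ≡ f k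
sum-one f k = trans (sum-snoc f k k) (trans (cong (_+ f k) (sum-empty f k)) (+-identityˡ (f k)))

-- Over a reversed range `sum` changes sign, hence the hypothesis `lo ≤ⁿ hi`.
sum-mono : ∀ {f g lo hi} → lo ≤ⁿ hi → (∀ j → lo ≤ⁿ j → j <ⁿ hi → f j ≤ g j) → sum f lo hi ≤ sum g lo hi
sum-mono {f} {g} {lo} lo≤hi = go (ℕₚ.≤⇒≤′ lo≤hi)
  where
  go : ∀ {hi} → lo ℕ.≤′ hi → (∀ j → lo ≤ⁿ j → j <ⁿ hi → f j ≤ g j) → sum f lo hi ≤ sum g lo hi
  go ℕ.≤′-refl h = ≤-reflexive (trans (sum-empty f lo) (sym (sum-empty g lo)))
  go (ℕ.≤′-step {n} lo≤n) h = begin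
    sum f lo (suc n)   ≡⟨ sum-snoc f lo n ⟩
    sum f lo n + f n   ≤⟨ go lo≤n (λ j l u → h j l (ℕₚ.m<n⇒m<1+n u)) ⊹ h n (ℕₚ.≤′⇒≤ lo≤n) ℕₚ.≤-refl ⟩
    sum g lo n + g n   ≡⟨ sum-snoc g lo n ⟨
    sum g lo (suc n)   ∎
    where open ≤-Reasoning

sum-cong : ∀ {f g lo hi} → lo ≤ⁿ hi → (∀ j → lo ≤ⁿ j → j <ⁿ hi → f j ≡ g j) → sum f lo hi ≡ sum g lo hi
sum-cong lo≤hi h = ≤-antisym (sum-mono lo≤hi (λ j l u → ≤-reflexive (h j l u)))
                             (sum-mono lo≤hi (λ j l u → ≤-reflexive (sym (h j l u))))

sum-zero : ∀ lo hi → sum (const 0ℚ) lo hi ≡ 0ℚ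
sum-zero lo hi = cong₂ _-_ (prefix-zero hi) (prefix-zero lo)
  where
  prefix-zero : ∀ n → prefix (const 0ℚ) n ≡ 0ℚ
  prefix-zero zero    = refl
  prefix-zero (suc n) = trans (+-identityʳ _) (prefix-zero n)

sum-nonneg : ∀ {f lo hi} → lo ≤ⁿ hi → (∀ j → 0ℚ ≤ f j) → 0ℚ ≤ sum f lo hi
sum-nonneg {f} {lo} {hi} lo≤hi h = subst (_≤ sum f lo hi) (sum-zero lo hi) (sum-mono lo≤hi (λ j _ _ → h j))

sum-+ : ∀ f g lo hi → sum (λ j → f j + g j) lo hi ≡ sum f lo hi + sum g lo hi
sum-+ f g lo hi = trans (cong₂ _-_ (prefix-+ hi) (prefix-+ lo))
  (solve 4 (λ x y z w → (x :+ y) :- (z :+ w) := (x :- z) :+ (y :- w)) refl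
    (prefix f hi) (prefix g hi) (prefix f lo) (prefix g lo))
  where
  prefix-+ : ∀ n → prefix (λ j → f j + g j) n ≡ prefix f n + prefix g n
  prefix-+ zero    = sym (+-identityʳ 0ℚ)
  prefix-+ (suc n) = trans (cong (_+ (f n + g n)) (prefix-+ n))
    (solve 4 (λ x y z w → (x :+ y) :+ (z :+ w) := (x :+ z) :+ (y :+ w)) refl (prefix f n) (prefix g n) (f n) (g n))

sum-sub : ∀ {f lo lo′ hi′ hi} → (∀ j → 0ℚ ≤ f j) → lo ≤ⁿ lo′ → lo′ ≤ⁿ hi′ → hi′ ≤ⁿ hi → sum f lo′ hi′ ≤ sum f lo hi
sum-sub {f} {lo} {lo′} {hi′} {hi} f≥0 l m u =
  linear (sum-nonneg l f≥0 ⊹ sum-nonneg u f≥0)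
    (solve 4 (λ w x y z → (y :- x) :+ ((x :- w) :+ (z :- y)) := (z :- w) :+ con0) refl
      (prefix f lo) (prefix f lo′) (prefix f hi′) (prefix f hi))

-- Comparisons and sets of keys

-- A plain sum lets `[ const _ , const _ ]′` select a branch; `compare-<` and `compare-≥` supply the
-- equations that rewrite such a selection.
compare : ∀ x c → (x <ⁿ c) ⊎ (c ≤ⁿ x)
compare x       zero    = inj₂ z≤n
compare zero    (suc c) = inj₁ z<s
compare (suc x) (suc c) = [ inj₁ ∘ s<s , inj₂ ∘ s≤s ]′ (compare x c)

compare-< : ∀ {x c} → x <ⁿ c → ∃ λ p → compare x c ≡ inj₁ p
compare-< {x} {c} x<c with compare x c
... | inj₁ p = p , refl
... | inj₂ q = contradiction x<c (ℕₚ.≤⇒≯ q)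

compare-≥ : ∀ {x c} → c ≤ⁿ x → ∃ λ p → compare x c ≡ inj₂ p
compare-≥ {x} {c} c≤x with compare x c
... | inj₁ p = contradiction c≤x (ℕₚ.<⇒≱ p)
... | inj₂ q = q , refl

≡ᵇ-refl : ∀ k → (k ≡ᵇ k) ≡ true
≡ᵇ-refl zero    = refl
≡ᵇ-refl (suc k) = ≡ᵇ-refl k

≢⇒≡ᵇ-false : ∀ j k → j ≢ k → (j ≡ᵇ k) ≡ false
≢⇒≡ᵇ-false zero    zero    j≢k = contradiction refl j≢k
≢⇒≡ᵇ-false zero    (suc k) j≢k = refl
≢⇒≡ᵇ-false (suc j) zero    j≢k = refl
≢⇒≡ᵇ-false (suc j) (suc k) j≢k = ≢⇒≡ᵇ-false j k (j≢k ∘ cong suc)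

infixl 6 _∖_ _∪_
_∖_ : (ℕ → Bool) → ℕ → ℕ → Bool
(al ∖ k) j = if j ≡ᵇ k then false else al j

_∪_ : (ℕ → Bool) → ℕ → ℕ → Bool
(P ∪ k) j = if j ≡ᵇ k then true else P j

∖-same : ∀ al k → (al ∖ k) k ≡ false
∖-same al k rewrite ≡ᵇ-refl k = refl

∖-other : ∀ al {j k} → j ≢ k → (al ∖ k) j ≡ al j
∖-other al {j} {k} j≢k rewrite ≢⇒≡ᵇ-false j k j≢k = refl

∪-other : ∀ P {j k} → j ≢ k → (P ∪ k) j ≡ P j
∪-other P {j} {k} j≢k rewrite ≢⇒≡ᵇ-false j k j≢k = refl

∖-false : ∀ al {j} k → al j ≡ false → (al ∖ k) j ≡ false
∖-false al {j} k e with j ≡ᵇ k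
... | true  = refl
... | false = e

Agree : (ℕ → Bool) → (ℕ → Bool) → ℕ → ℕ → Set
Agree f g lo hi = ∀ j → lo ≤ⁿ j → j <ⁿ hi → f j ≡ g j

agree-refl : ∀ {f lo hi} → Agree f f lo hi
agree-refl j _ _ = refl

agree-sym : ∀ {f g lo hi} → Agree f g lo hi → Agree g f lo hi
agree-sym h j l u = sym (h j l u)

agree-sub : ∀ {f g lo lo′ hi′ hi} → lo ≤ⁿ lo′ → hi′ ≤ⁿ hi → Agree f g lo hi → Agree f g lo′ hi′
agree-sub l u h j lj ju = h j (ℕₚ.≤-trans l lj) (ℕₚ.<-≤-trans ju u)

agree-∖ : ∀ {f g lo hi} k → Agree f g lo hi → Agree (f ∖ k) (g ∖ k) lo hi
agree-∖ k h j l u with j ≡ᵇ k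
... | true  = refl
... | false = h j l u

∖-below : ∀ f {lo hi k} → hi ≤ⁿ k → Agree (f ∖ k) f lo hi
∖-below f hi≤k j l u = ∖-other f (ℕₚ.<⇒≢ (ℕₚ.<-≤-trans u hi≤k))

∖-above : ∀ f {lo hi k} → k <ⁿ lo → Agree (f ∖ k) f lo hi
∖-above f k<lo j l u = ∖-other f (ℕₚ.>⇒≢ (ℕₚ.<-≤-trans k<lo l))

∪-below : ∀ f {lo hi k} → hi ≤ⁿ k → Agree (f ∪ k) f lo hi
∪-below f hi≤k j l u = ∪-other f (ℕₚ.<⇒≢ (ℕₚ.<-≤-trans u hi≤k))

∪-above : ∀ f {lo hi k} → k <ⁿ lo → Agree (f ∪ k) f lo hi
∪-above f k<lo j l u = ∪-other f (ℕₚ.>⇒≢ (ℕₚ.<-≤-trans k<lo l))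

-- Skeletons and their restriction to one side of a cut

-- A search tree without leaf labels; the yes-branch of an equality test is a leaf and is left out.
data Skeleton : Set where
  lf : Skeleton
  eq : ℕ → Skeleton → Skeleton
  lt : ℕ → Skeleton → Skeleton → Skeleton

size : Skeleton → ℕ
size lf         = 0
size (eq _ t)   = suc (size t)
size (lt _ t u) = suc (size t +ⁿ size u)

-- al marks the keys not tested above, and lo ≤ j < hi are the bricks reaching the tree.
data Valid : (ℕ → Bool) → Skeleton → ℕ → ℕ → Set where
  lf : ∀ {al lo hi} → lo <ⁿ hi → (∀ j → lo ≤ⁿ j → j <ⁿ hi → al j ≡ false) → Valid al lf lo hi
  eq : ∀ {al k t lo hi} → lo ≤ⁿ k → k <ⁿ hi → al k ≡ true → Valid (al ∖ k) t lo hi → Valid al (eq k t) lo hi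
  lt : ∀ {al c t u lo hi} → lo <ⁿ c → c <ⁿ hi → Valid al t lo c → Valid al u c hi → Valid al (lt c t u) lo hi

valid-cong : ∀ {al al′ t lo hi} → Agree al al′ lo hi → Valid al t lo hi → Valid al′ t lo hi
valid-cong h (lf l f)        = lf l (λ j lj ju → trans (sym (h j lj ju)) (f j lj ju))
valid-cong h (eq {k = k} l u e v) = eq l u (trans (sym (h k l u)) e) (valid-cong (agree-∖ k h) v)
valid-cong h (lt l u v w)    = lt l u (valid-cong (agree-sub ℕₚ.≤-refl (ℕₚ.<⇒≤ u) h) v)
                                      (valid-cong (agree-sub (ℕₚ.<⇒≤ l) ℕₚ.≤-refl h) w)

-- A test that has the same answer for all bricks on the chosen side is dropped. An inequality test
-- at `c` itself is dropped by both `below` and `above`, which then continue in its yes- and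
-- no-subtree.
below : ℕ → Skeleton → Skeleton
below c lf         = lf
below c (eq x t)   = [ const (eq x (below c t)) , const (below c t) ]′ (compare x c)
below c (lt d t u) = [ const (lt d t (below c u)) , const (below c t) ]′ (compare d c)

above : ℕ → Skeleton → Skeleton
above c lf         = lf
above c (eq x t)   = [ const (above c t) , const (eq x (above c t)) ]′ (compare x c)
above c (lt d t u) = [ const (lt d (above c t) u) , const (above c u) ]′ (compare c d)

below-size : ∀ c t → size (below c t) ≤ⁿ size t
below-size c lf = z≤n
below-size c (eq x t) with compare x c
... | inj₁ _ = s≤s (below-size c t)
... | inj₂ _ = ℕₚ.m≤n⇒m≤1+n (below-size c t)
below-size c (lt d t u) with compare d c
... | inj₁ _ = s≤s (ℕₚ.+-monoʳ-≤ (size t) (below-size c u))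
... | inj₂ _ = ℕₚ.m≤n⇒m≤1+n (ℕₚ.≤-trans (below-size c t) (ℕₚ.m≤m+n (size t) (size u)))

above-size : ∀ c t → size (above c t) ≤ⁿ size t
above-size c lf = z≤n
above-size c (eq x t) with compare x c
... | inj₁ _ = ℕₚ.m≤n⇒m≤1+n (above-size c t)
... | inj₂ _ = s≤s (above-size c t)
above-size c (lt d t u) with compare c d
... | inj₁ _ = s≤s (ℕₚ.+-monoˡ-≤ (size u) (above-size c t))
... | inj₂ _ = ℕₚ.m≤n⇒m≤1+n (ℕₚ.≤-trans (above-size c u) (ℕₚ.m≤n+m (size u) (size t)))

-- When `eq x` is dropped, `x` lies outside the remaining interval, so there the set of live keys is
-- the same with and without `x`.
below-valid : ∀ {al t lo c hi} → Valid al t lo hi → lo <ⁿ c → c ≤ⁿ hi → Valid al (below c t) lo c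
below-valid (lf l f) lc ch = lf lc (λ j lj ju → f j lj (ℕₚ.<-≤-trans ju ch))
below-valid {al} {c = c} (eq {k = x} l u e v) lc ch with compare x c
... | inj₁ x<c = eq l x<c e (below-valid v lc ch)
... | inj₂ c≤x = valid-cong (∖-below al c≤x) (below-valid v lc ch)
below-valid {c = c} (lt {c = d} l u v w) lc ch with compare d c
... | inj₁ d<c = lt l d<c v (below-valid w d<c ch)
... | inj₂ c≤d = below-valid v lc c≤d

above-valid : ∀ {al t lo c hi} → Valid al t lo hi → lo ≤ⁿ c → c <ⁿ hi → Valid al (above c t) c hi
above-valid (lf l f) lc ch = lf ch (λ j lj ju → f j (ℕₚ.≤-trans lc lj) ju)
above-valid {al} {c = c} (eq {k = x} l u e v) lc ch with compare x c
... | inj₁ x<c = valid-cong (∖-above al x<c) (above-valid v lc ch)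
... | inj₂ c≤x = eq c≤x u e (above-valid v lc ch)
above-valid {c = c} (lt {c = d} l u v w) lc ch with compare c d
... | inj₁ c<d = lt c<d u (above-valid v lc c<d) w
... | inj₂ d≤c = above-valid w d≤c ch

-- Validity keeps every tested key inside the interval, so a cut at or beyond its end decides none
-- of the tests.
below-id : ∀ {al t lo hi c} → Valid al t lo hi → hi ≤ⁿ c → below c t ≡ t
below-id (lf _ _) _ = refl
below-id {c = c} (eq {k = x} l u e v) h with compare x c
... | inj₁ _   = cong (eq x) (below-id v h)
... | inj₂ c≤x = contradiction (ℕₚ.<-≤-trans u h) (ℕₚ.≤⇒≯ c≤x)
below-id {c = c} (lt {c = d} {t = t} l u v w) h with compare d c
... | inj₁ _   = cong (lt d t) (below-id w h)
... | inj₂ c≤d = contradiction (ℕₚ.<-≤-trans u h) (ℕₚ.≤⇒≯ c≤d)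

above-id : ∀ {al t lo hi c} → Valid al t lo hi → c ≤ⁿ lo → above c t ≡ t
above-id (lf _ _) _ = refl
above-id {c = c} (eq {k = x} l u e v) h with compare x c
... | inj₁ x<c = contradiction (ℕₚ.≤-trans h l) (ℕₚ.<⇒≱ x<c)
... | inj₂ _   = cong (eq x) (above-id v h)
above-id {c = c} (lt {c = d} {u = t′} l u v w) h with compare c d
... | inj₁ _   = cong (λ z → lt d z t′) (above-id v h)
... | inj₂ d≤c = contradiction (ℕₚ.≤-trans d≤c h) (ℕₚ.<⇒≱ l)

-- The leaf reached by a gap, and the side of the root

-- With `leafHi`, the ends of the interval of the leaf that gap `k` reaches; a gap answers every
-- equality test with no.
leafLo : Skeleton → ℕ → ℕ → ℕ
leafLo lf         k lo = lo
leafLo (eq _ t)   k lo = leafLo t k lo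
leafLo (lt d t u) k lo = [ const (leafLo t k lo) , const (leafLo u k d) ]′ (compare k d)

leafHi : Skeleton → ℕ → ℕ → ℕ
leafHi lf         k hi = hi
leafHi (eq _ t)   k hi = leafHi t k hi
leafHi (lt d t u) k hi = [ const (leafHi t k d) , const (leafHi u k hi) ]′ (compare k d)

leafLo-bounds : ∀ {al t lo hi k} → Valid al t lo hi → lo ≤ⁿ k → lo ≤ⁿ leafLo t k lo × leafLo t k lo ≤ⁿ k
leafLo-bounds (lf _ _) h = ℕₚ.≤-refl , h
leafLo-bounds (eq _ _ _ v) h = leafLo-bounds v h
leafLo-bounds {k = k} (lt {c = d} l u v w) h with compare k d
... | inj₁ _ = leafLo-bounds v h
... | inj₂ q with leafLo-bounds w q
...   | x , y = ℕₚ.≤-trans (ℕₚ.<⇒≤ l) x , y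

leafHi-bounds : ∀ {al t lo hi k} → Valid al t lo hi → k <ⁿ hi → k <ⁿ leafHi t k hi × leafHi t k hi ≤ⁿ hi
leafHi-bounds (lf _ _) h = h , ℕₚ.≤-refl
leafHi-bounds (eq _ _ _ v) h = leafHi-bounds v h
leafHi-bounds {k = k} (lt {c = d} l u v w) h with compare k d
... | inj₂ _ = leafHi-bounds w h
... | inj₁ q with leafHi-bounds v q
...   | x , y = x , ℕₚ.≤-trans y (ℕₚ.<⇒≤ u)

-- The lower end of the leaf is set by inequality tests at keys up to `k`, and all of these survive
-- the restriction.
leafLo-below : ∀ t k lo → leafLo (below (suc k) t) k lo ≡ leafLo t k lo
leafLo-below lf k lo = refl
leafLo-below (eq x t) k lo with compare x (suc k)
... | inj₁ _ = leafLo-below t k lo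
... | inj₂ _ = leafLo-below t k lo
leafLo-below (lt d t u) k lo with compare d (suc k)
... | inj₁ (s≤s d≤k) rewrite proj₂ (compare-≥ d≤k) = leafLo-below u k d
... | inj₂ k<d rewrite proj₂ (compare-< k<d) = leafLo-below t k lo

-- The root's test is decided for the bricks from `c` on; for `RightRoot` it is decided for those
-- before `c`. An inequality test at `c` is both, and a leaf, which has no test to save, is neither.
LeftRoot : ℕ → Skeleton → Set
LeftRoot c lf         = ⊥
LeftRoot c (eq x _)   = x <ⁿ c
LeftRoot c (lt d _ _) = d ≤ⁿ c

RightRoot : ℕ → Skeleton → Set
RightRoot c lf         = ⊥
RightRoot c (eq x _)   = c ≤ⁿ x
RightRoot c (lt d _ _) = c ≤ⁿ d

-- Depths as rational numbers, and searches in terms of brick numbers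

ℕ→ℚ-suc : ∀ d → ℕ→ℚ (suc d) ≡ 1ℚ + ℕ→ℚ d
ℕ→ℚ-suc d = sym (trans
  -- The gcd in `(+ d) / 1` is stuck on the variable `d`; the round trip identifies this number with
  -- an explicit fraction, on which addition computes.
  (cong (1ℚ +_) (fromℚᵘ-toℚᵘ (ℚ.mkℚ (ℤ.+ d) 0 (Coprimality.sym (Coprimality.1-coprimeTo d)))))
  (cong (λ z → (ℤ.1ℤ ℤ.+ z) ℚ./ 1) (ℤₚ.*-identityʳ (ℤ.+ d))))

ℕ→ℚ≥0 : ∀ d → 0ℚ ≤ ℕ→ℚ d
ℕ→ℚ≥0 zero    = ≤-refl
ℕ→ℚ≥0 (suc d) = subst (0ℚ ≤_) (sym (ℕ→ℚ-suc d)) (nonNegative⁻¹ 1ℚ ⊹ ℕ→ℚ≥0 d)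

scale-suc : ∀ p d → p * ℕ→ℚ (suc d) ≡ p + p * ℕ→ℚ d
scale-suc p d = trans (cong (p *_) (ℕ→ℚ-suc d)) (trans (*-distribˡ-+ p 1ℚ (ℕ→ℚ d)) (cong (_+ p * ℕ→ℚ d) (*-identityʳ p)))

scale≥0 : ∀ {p} d → 0ℚ ≤ p → 0ℚ ≤ p * ℕ→ℚ d
scale≥0 {p} d p≥0 = subst (_≤ p * ℕ→ℚ d) (*-zeroʳ p) (*-monoˡ-≤-nonNeg p {{ℚ.nonNegative p≥0}} (ℕ→ℚ≥0 d))

isYes-true : ∀ {A : Set} (d : Dec A) → A → ⌊ d ⌋ ≡ true
isYes-true d p = trans (isYes≗does d) (dec-true d p)

isYes-false : ∀ {A : Set} (d : Dec A) → ¬ A → ⌊ d ⌋ ≡ false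
isYes-false d p = trans (isYes≗does d) (dec-false d p)

module _ {n : ℕ} where

  keyNumber : Fin n → ℕ
  keyNumber k = suc (toℕ k)

  answer-eq-hit : ∀ (k : Fin n) → answer eqT k (key k) ≡ true
  answer-eq-hit k = isYes-true (k Fin.≟ k) refl

  answer-eq-miss : ∀ {k i : Fin n} → keyNumber i ≢ keyNumber k → answer eqT k (key i) ≡ false
  answer-eq-miss {k} {i} i≢k = isYes-false (i Fin.≟ k) (i≢k ∘ cong keyNumber)

  -- The `≤` between indices becomes `<` between brick numbers. Gaps and keys are thus sorted by the
  -- same comparison, and an inequality test never splits a brick.
  answer-lt-gap : ∀ (k : Fin n) (i : Fin (suc n)) →
    answer ltT k (gap i) ≡ [ const true , const false ]′ (compare (toℕ i) (keyNumber k))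
  answer-lt-gap k i with compare (toℕ i) (keyNumber k)
  ... | inj₁ (s≤s i≤k) = isYes-true (toℕ i ℕ.≤? toℕ k) i≤k
  ... | inj₂ k<i       = isYes-false (toℕ i ℕ.≤? toℕ k) (ℕₚ.<⇒≱ k<i)

  answer-lt-key : ∀ (k i : Fin n) →
    answer ltT k (key i) ≡ [ const true , const false ]′ (compare (keyNumber i) (keyNumber k))
  answer-lt-key k i with compare (keyNumber i) (keyNumber k)
  ... | inj₁ (s≤s i<k) = isYes-true (toℕ i ℕ.<? toℕ k) i<k
  ... | inj₂ k≤i       = isYes-false (toℕ i ℕ.<? toℕ k) (ℕₚ.≤⇒≯ (ℕₚ.≤-pred k≤i))

  module _ {L : Set} where

    search-yes : ∀ c k (t u : Tree n L) {q} → answer c k q ≡ true → search (node c k t u) q ≡ search t q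
    search-yes c k t u e = cong (λ x → if x then search t _ else search u _) e

    search-no : ∀ c k (t u : Tree n L) {q} → answer c k q ≡ false → search (node c k t u) q ≡ search u q
    search-no c k t u e = cong (λ x → if x then search t _ else search u _) e

    -- `gapDepth` and `keyDepth` are total on brick numbers, so that depths can be summed over
    -- ranges.
    gapDepth : Tree n L → ℕ → ℕ
    gapDepth (leaf _)         j = 0
    gapDepth (node eqT k t u) j = suc (gapDepth u j)
    gapDepth (node ltT k t u) j = suc ([ const (gapDepth t j) , const (gapDepth u j) ]′ (compare j (keyNumber k)))

    keyDepth : Tree n L → ℕ → ℕ
    keyDepth (leaf _)         j = 0
    keyDepth (node eqT k t u) j = suc (if j ≡ᵇ keyNumber k then keyDepth t j else keyDepth u j)
    keyDepth (node ltT k t u) j = suc ([ const (keyDepth t j) , const (keyDepth u j) ]′ (compare j (keyNumber k)))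

    depth-gap : ∀ (T : Tree n L) i → depth T (gap i) ≡ gapDepth T (toℕ i)
    depth-gap (leaf _)         i = refl
    depth-gap (node eqT k t u) i = cong suc (depth-gap u i)
    depth-gap (node ltT k t u) i rewrite answer-lt-gap k i with compare (toℕ i) (keyNumber k)
    ... | inj₁ _ = cong suc (depth-gap t i)
    ... | inj₂ _ = cong suc (depth-gap u i)

    depth-key : ∀ (T : Tree n L) i → depth T (key i) ≡ keyDepth T (keyNumber i)
    depth-key (leaf _)         i = refl
    depth-key (node eqT k t u) i with i Fin.≟ k
    ... | yes refl rewrite ≡ᵇ-refl (toℕ k) = cong suc (depth-key t i)
    ... | no i≢k rewrite ≢⇒≡ᵇ-false (toℕ i) (toℕ k) (i≢k ∘ toℕ-injective) = cong suc (depth-key u i)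
    depth-key (node ltT k t u) i rewrite answer-lt-key k i with compare (keyNumber i) (keyNumber k)
    ... | inj₁ _ = cong suc (depth-key t i)
    ... | inj₂ _ = cong suc (depth-key u i)

-- The contribution to the expected depth of a brick whose gap has weight p and depth d and whose key, if present,
-- has weight q and depth e.
share : Bool → ℚ → ℚ → ℕ → ℕ → ℚ
share x p q d e = p * ℕ→ℚ d + (if x then q * ℕ→ℚ e else 0ℚ)

share-suc : ∀ x p q d e → share x p q (suc d) (suc e) ≡ p + (if x then q else 0ℚ) + share x p q d e
share-suc true  p q d e = trans (cong₂ _+_ (scale-suc p d) (scale-suc q e))
  (solve 4 (λ a b x y → a :+ x :+ (b :+ y) := a :+ b :+ (x :+ y)) refl p q (p * ℕ→ℚ d) (q * ℕ→ℚ e))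
share-suc false p q d e = trans (+-identityʳ (p * ℕ→ℚ (suc d))) (trans (scale-suc p d)
  (sym (cong₂ _+_ (+-identityʳ p) (+-identityʳ (p * ℕ→ℚ d)))))

-- A key found at depth 0 costs as little as an absent one; this is why the yes-leaf of an equality
-- test can be left out of a skeleton.
share-zero : ∀ x p q d e → share x p q d 0 ≡ share false p q d e
share-zero true  p q d e = cong (p * ℕ→ℚ d +_) (*-zeroʳ q)
share-zero false p q d e = refl

share-drop : ∀ x p {q} d e e′ → 0ℚ ≤ q → share false p q d e ≤ share x p q d e′
share-drop true  p d e e′ q≥0 = +-monoʳ-≤ (p * ℕ→ℚ d) (scale≥0 e′ q≥0)
share-drop false p d e e′ q≥0 = ≤-refl

share≥0 : ∀ x {p q} d e → 0ℚ ≤ p → 0ℚ ≤ q → 0ℚ ≤ share x p q d e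
share≥0 true  d e p≥0 q≥0 = scale≥0 d p≥0 ⊹ scale≥0 e q≥0
share≥0 false d e p≥0 q≥0 = scale≥0 d p≥0 ⊹ ≤-refl

share-mono : ∀ x {p q} d e → 0ℚ ≤ p → 0ℚ ≤ q → share x p q d e ≤ share x p q (suc d) (suc e)
share-mono x {p} {q} d e p≥0 q≥0 = ≤-trans
  (≤-trans (≤-reflexive (sym (+-identityˡ (share x p q d e)))) (bound x ⊹ ≤-refl))
  (≤-reflexive (sym (share-suc x p q d e)))
  where
  bound : ∀ x → 0ℚ ≤ p + (if x then q else 0ℚ)
  bound true  = p≥0 ⊹ q≥0
  bound false = p≥0 ⊹ ≤-refl

-- Weights of bricks

module Weights (a b : ℕ → ℚ) (a≥0 : ∀ j → 0ℚ ≤ a j) (b≥0 : ∀ j → 0ℚ ≤ b j) where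

  keyWeight : (ℕ → Bool) → ℕ → ℚ
  keyWeight al j = if al j then b j else 0ℚ

  keyWeight≥0 : ∀ al j → 0ℚ ≤ keyWeight al j
  keyWeight≥0 al j with al j
  ... | true  = b≥0 j
  ... | false = ≤-refl

  brick : (ℕ → Bool) → ℕ → ℚ
  brick al j = a j + keyWeight al j

  brick≥0 : ∀ al j → 0ℚ ≤ brick al j
  brick≥0 al j = a≥0 j ⊹ keyWeight≥0 al j

  weight : (ℕ → Bool) → ℕ → ℕ → ℚ
  weight al = sum (brick al)

  weight≥0 : ∀ al {lo hi} → lo ≤ⁿ hi → 0ℚ ≤ weight al lo hi
  weight≥0 al lo≤hi = sum-nonneg lo≤hi (brick≥0 al)

  weight-cong : ∀ {al al′ lo hi} → lo ≤ⁿ hi → Agree al al′ lo hi → weight al lo hi ≡ weight al′ lo hi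
  weight-cong lo≤hi h = sum-cong lo≤hi (λ j l u → cong (λ x → a j + (if x then b j else 0ℚ)) (h j l u))

  gaps≤weight : ∀ al {lo hi} → lo ≤ⁿ hi → sum a lo hi ≤ weight al lo hi
  gaps≤weight al lo≤hi = sum-mono lo≤hi (λ j _ _ →
    linear (keyWeight≥0 al j) (solve 2 (λ x y → x :+ y := (x :+ y) :+ con0) refl (a j) (keyWeight al j)))

  weight-dead : ∀ {al lo hi} → lo ≤ⁿ hi → (∀ j → lo ≤ⁿ j → j <ⁿ hi → al j ≡ false) → weight al lo hi ≡ sum a lo hi
  weight-dead lo≤hi h = sum-cong lo≤hi (λ j l u →
    trans (cong (λ x → a j + (if x then b j else 0ℚ)) (h j l u)) (+-identityʳ (a j)))

  -- Split the range into the bricks before, at and after `k`; only the middle one changes.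
  weight-∖ : ∀ {al lo hi k} → lo ≤ⁿ k → k <ⁿ hi → al k ≡ true → weight (al ∖ k) lo hi + b k ≡ weight al lo hi
  weight-∖ {al} {lo} {hi} {k} l u e = begin
    weight (al ∖ k) lo hi + b k
      ≡⟨ cong (_+ b k) (three (brick (al ∖ k))) ⟨
    (weight (al ∖ k) lo k + brick (al ∖ k) k + weight (al ∖ k) (suc k) hi) + b k
      ≡⟨ cong (_+ b k) (cong₂ _+_ (cong₂ _+_ (weight-cong l (∖-below al ℕₚ.≤-refl)) here)
           (weight-cong u (∖-above al ℕₚ.≤-refl))) ⟩
    (weight al lo k + a k + weight al (suc k) hi) + b k
      ≡⟨ solve 4 (λ x y z w → (x :+ y :+ z) :+ w := x :+ (y :+ w) :+ z) refl
           (weight al lo k) (a k) (weight al (suc k) hi) (b k) ⟩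
    weight al lo k + (a k + b k) + weight al (suc k) hi
      ≡⟨ cong (λ x → weight al lo k + (a k + (if x then b k else 0ℚ)) + weight al (suc k) hi) e ⟨
    weight al lo k + brick al k + weight al (suc k) hi
      ≡⟨ three (brick al) ⟩
    weight al lo hi ∎
    where
    open ≡-Reasoning
    three : ∀ f → sum f lo k + f k + sum f (suc k) hi ≡ sum f lo hi
    three f = trans (cong (_+ sum f (suc k) hi) (sym (sum-snoc f lo k))) (sum-split f lo (suc k) hi)
    here : brick (al ∖ k) k ≡ a k
    here = trans (cong (λ x → a k + (if x then b k else 0ℚ)) (∖-same al k)) (+-identityʳ (a k))

  -- The cost of a skeleton with pending cuts

  charge : (ℕ → Bool) → ℚ → ℕ → ℚ
  charge P w j = if P j then w else 0ℚ

  -- P marks the keys at which a leaf has yet to be cut; each such cut is charged the weight of the whole leaf.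
  treeCost : (ℕ → Bool) → (ℕ → Bool) → Skeleton → ℕ → ℕ → ℚ
  treeCost al P lf         lo hi = sum (charge P (weight al lo hi)) (suc lo) hi
  treeCost al P (eq k t)   lo hi = weight al lo hi + treeCost (al ∖ k) P t lo hi
  treeCost al P (lt c t u) lo hi = weight al lo hi + (treeCost al P t lo c + treeCost al P u c hi)

  drop : ∀ {p q r} → 0ℚ ≤ q → p + q ≤ r → p ≤ r
  drop {p} {q} {r} q≥0 h = linear (q≥0 ⊹ h) (solve 3 (λ p q r → p :+ (q :+ r) := r :+ (con0 :+ (p :+ q))) refl p q r)

  charge≥0 : ∀ P {w} → 0ℚ ≤ w → ∀ j → 0ℚ ≤ charge P w j
  charge≥0 P w≥0 j with P j
  ... | true  = w≥0
  ... | false = ≤-refl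

  charge-mono : ∀ P {w w′} → w ≤ w′ → ∀ j → charge P w j ≤ charge P w′ j
  charge-mono P w≤w′ j with P j
  ... | true  = w≤w′
  ... | false = ≤-refl

  valid-range : ∀ {al t lo hi} → Valid al t lo hi → lo <ⁿ hi
  valid-range (lf l _)     = l
  valid-range (eq l u _ _) = ℕₚ.≤-<-trans l u
  valid-range (lt l u _ _) = ℕₚ.<-trans l u

  treeCost-cong : ∀ {al al′ P P′ t lo hi} → Valid al t lo hi → Agree al al′ lo hi → Agree P P′ (suc lo) hi →
                  treeCost al P t lo hi ≡ treeCost al′ P′ t lo hi
  treeCost-cong {P = P} {P′} (lf l _) h g = sum-cong l (λ j lj ju →
    cong₂ (λ x w → if x then w else 0ℚ) (g j lj ju) (weight-cong (ℕₚ.<⇒≤ l) h))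
  treeCost-cong v@(eq {k = k} _ _ _ v′) h g =
    cong₂ _+_ (weight-cong (ℕₚ.<⇒≤ (valid-range v)) h) (treeCost-cong v′ (agree-∖ k h) g)
  treeCost-cong (lt l u v w) h g =
    cong₂ _+_ (weight-cong (ℕₚ.<⇒≤ (ℕₚ.<-trans l u)) h)
      (cong₂ _+_ (treeCost-cong v (agree-sub ℕₚ.≤-refl (ℕₚ.<⇒≤ u) h) (agree-sub ℕₚ.≤-refl (ℕₚ.<⇒≤ u) g))
                 (treeCost-cong w (agree-sub (ℕₚ.<⇒≤ l) ℕₚ.≤-refl h) (agree-sub (s≤s (ℕₚ.<⇒≤ l)) ℕₚ.≤-refl g)))

  -- Only the leaf of gap `k` can pay for the new pending cut, and its weight consists of gaps alone
  -- because its keys have all been tested. Nothing is added if `k` is already in `P` or is the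
  -- lower end of the leaf.
  treeCost-∪ : ∀ {al P k t lo hi} → Valid al t lo hi → lo ≤ⁿ k → k <ⁿ hi →
               treeCost al (P ∪ k) t lo hi ≤ treeCost al P t lo hi + sum a (leafLo t k lo) (leafHi t k hi)
  treeCost-∪ {al} {P} {k} {lo = lo} {hi} (lf lo<hi dead) l u = begin
    sum (charge (P ∪ k) w) (suc lo) hi
      ≤⟨ sum-mono lo<hi (λ j _ _ → pointwise j) ⟩
    sum (λ j → charge P w j + δ j) (suc lo) hi
      ≡⟨ sum-+ (charge P w) δ (suc lo) hi ⟩
    sum (charge P w) (suc lo) hi + sum δ (suc lo) hi
      ≤⟨ +-monoʳ-≤ (sum (charge P w) (suc lo) hi) δ-sum ⟩
    sum (charge P w) (suc lo) hi + w
      ≡⟨ cong (sum (charge P w) (suc lo) hi +_) (weight-dead (ℕₚ.<⇒≤ lo<hi) dead) ⟩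
    sum (charge P w) (suc lo) hi + sum a lo hi ∎
    where
    open ≤-Reasoning
    w = weight al lo hi
    w≥0 = weight≥0 al {lo} {hi} (ℕₚ.<⇒≤ lo<hi)
    δ : ℕ → ℚ
    δ j = if j ≡ᵇ k then w else 0ℚ
    δ≥0 : ∀ j → 0ℚ ≤ δ j
    δ≥0 j with j ≡ᵇ k
    ... | true  = w≥0
    ... | false = ≤-refl
    pointwise : ∀ j → charge (P ∪ k) w j ≤ charge P w j + δ j
    pointwise j with j ≡ᵇ k
    ... | true  = ≤-trans (≤-reflexive (sym (+-identityˡ w))) (charge≥0 P w≥0 j ⊹ ≤-refl)
    ... | false = ≤-reflexive (sym (+-identityʳ (charge P w j)))
    δ-off : ∀ {lo hi} → lo ≤ⁿ hi → (∀ j → lo ≤ⁿ j → j <ⁿ hi → j ≢ k) → sum δ lo hi ≡ 0ℚ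
    δ-off {lo} {hi} lo≤hi off = trans (sum-cong lo≤hi (λ j lj ju → off′ j (off j lj ju))) (sum-zero lo hi)
      where
      off′ : ∀ j → j ≢ k → δ j ≡ 0ℚ
      off′ j j≢k rewrite ≢⇒≡ᵇ-false j k j≢k = refl
    δ-sum : sum δ (suc lo) hi ≤ w
    δ-sum = begin
      -- The range is widened to start at `lo`, since `k` may be `lo`, and then split around `k`.
      sum δ (suc lo) hi                                            ≤⟨ sum-sub δ≥0 (ℕₚ.n≤1+n lo) lo<hi ℕₚ.≤-refl ⟩
      sum δ lo hi                                                  ≡⟨ sum-split δ lo k hi ⟨
      sum δ lo k + sum δ k hi                                      ≡⟨ cong (sum δ lo k +_) (sum-split δ k (suc k) hi) ⟨
      sum δ lo k + (sum δ k (suc k) + sum δ (suc k) hi)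
        ≡⟨ cong₂ (λ x y → x + (sum δ k (suc k) + y)) (δ-off l (λ j _ → ℕₚ.<⇒≢)) (δ-off u (λ j p _ → ℕₚ.>⇒≢ p)) ⟩
      0ℚ + (sum δ k (suc k) + 0ℚ)                                  ≡⟨ trans (+-identityˡ _) (+-identityʳ _) ⟩
      sum δ k (suc k)                                              ≡⟨ sum-one δ k ⟩
      δ k                                                          ≡⟨ cong (λ x → if x then w else 0ℚ) (≡ᵇ-refl k) ⟩
      w                                                            ∎
  treeCost-∪ {al} {P} {k} {lo = lo} {hi} (eq {k = x} {t} _ _ _ v) l u =
    linear (treeCost-∪ {P = P} v l u)
      (solve 4 (λ w x y z → (w :+ x) :+ (y :+ z) := ((w :+ y) :+ z) :+ x) refl
        (weight al lo hi) (treeCost (al ∖ x) (P ∪ k) t lo hi) (treeCost (al ∖ x) P t lo hi) (sum a (leafLo t k lo) (leafHi t k hi)))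
  treeCost-∪ {al} {P} {k} {lo = lo} {hi} (lt {c = d} {t} {t′} ld du v w) l u with compare k d
  ... | inj₁ k<d = linear (treeCost-∪ {P = P} v l k<d ⊹ ≤-reflexive (treeCost-cong w agree-refl (∪-above P (ℕₚ.m<n⇒m<1+n k<d))))
      (solve 6 (λ w x y z p q → (w :+ (x :+ y)) :+ ((z :+ p) :+ q) := ((w :+ (z :+ q)) :+ p) :+ (x :+ y)) refl
        (weight al lo hi) (treeCost al (P ∪ k) t lo d) (treeCost al (P ∪ k) t′ d hi) (treeCost al P t lo d)
        (sum a (leafLo t k lo) (leafHi t k d)) (treeCost al P t′ d hi))
  ... | inj₂ d≤k = linear (treeCost-∪ {P = P} w d≤k u ⊹ ≤-reflexive (treeCost-cong v agree-refl (∪-below P d≤k)))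
      (solve 6 (λ w x y z p q → (w :+ (x :+ y)) :+ ((z :+ p) :+ q) := ((w :+ (q :+ z)) :+ p) :+ (y :+ x)) refl
        (weight al lo hi) (treeCost al (P ∪ k) t lo d) (treeCost al (P ∪ k) t′ d hi) (treeCost al P t′ d hi)
        (sum a (leafLo t′ k d) (leafHi t′ k hi)) (treeCost al P t lo d))

  -- Each pending cut is now charged the weight of a smaller leaf, and a cut pending at `c` is no
  -- longer charged.
  lf-split : ∀ {al P lo c hi} → lo <ⁿ c → c <ⁿ hi →
             treeCost al P lf lo c + treeCost al P lf c hi ≤ treeCost al P lf lo hi
  lf-split {al} {P} {lo} {c} {hi} l u = begin
    treeCost al P lf lo c + treeCost al P lf c hi
      ≤⟨ sum-mono l (λ j _ _ → charge-mono P (sum-sub (brick≥0 al) ℕₚ.≤-refl (ℕₚ.<⇒≤ l) (ℕₚ.<⇒≤ u)) j)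
         ⊹ sum-mono u (λ j _ _ → charge-mono P (sum-sub (brick≥0 al) (ℕₚ.<⇒≤ l) (ℕₚ.<⇒≤ u) ℕₚ.≤-refl) j) ⟩
    sum f (suc lo) c + sum f (suc c) hi
      ≤⟨ +-monoʳ-≤ (sum f (suc lo) c) (sum-sub f≥0 (ℕₚ.n≤1+n c) u ℕₚ.≤-refl) ⟩
    sum f (suc lo) c + sum f c hi
      ≡⟨ sum-split f (suc lo) c hi ⟩
    sum f (suc lo) hi ∎
    where
    open ≤-Reasoning
    f = charge P (weight al lo hi)
    f≥0 = charge≥0 P (weight≥0 al (ℕₚ.<⇒≤ (ℕₚ.<-trans l u)))

  -- Savings made by a cut

  -- Cutting a tree at c, the queries on one side no longer meet the root if the root's test is decided on that side.
  split-cost : ∀ {al P t lo c hi} → Valid al t lo hi → lo <ⁿ c → c <ⁿ hi →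
               treeCost al P (below c t) lo c + treeCost al P (above c t) c hi ≤ treeCost al P t lo hi
  split-cost-left : ∀ {al P t lo c hi} → Valid al t lo hi → lo <ⁿ c → c <ⁿ hi → LeftRoot c t →
    treeCost al P (below c t) lo c + treeCost al P (above c t) c hi + weight al c hi ≤ treeCost al P t lo hi
  split-cost-right : ∀ {al P t lo c hi} → Valid al t lo hi → lo <ⁿ c → c <ⁿ hi → RightRoot c t →
    treeCost al P (below c t) lo c + treeCost al P (above c t) c hi + weight al lo c ≤ treeCost al P t lo hi

  split-cost {al} {P} (lf _ _) l u = lf-split {al} {P} l u
  -- Every inner root is a left or a right root; here its saving is given away.
  split-cost {al} {P} {c = c} v@(eq {k = x} _ _ _ _) l u =
    [ (λ x<c → drop (weight≥0 al (ℕₚ.<⇒≤ u)) (split-cost-left {P = P} v l u x<c))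
    , (λ c≤x → drop (weight≥0 al (ℕₚ.<⇒≤ l)) (split-cost-right {P = P} v l u c≤x)) ]′ (compare x c)
  split-cost {al} {P} {c = c} v@(lt {c = d} _ _ _ _) l u =
    [ (λ d<c → drop (weight≥0 al (ℕₚ.<⇒≤ u)) (split-cost-left {P = P} v l u (ℕₚ.<⇒≤ d<c)))
    , (λ c≤d → drop (weight≥0 al (ℕₚ.<⇒≤ l)) (split-cost-right {P = P} v l u c≤d)) ]′ (compare d c)

  split-cost-left {al} {P} {c = c} {hi} (lf _ _) l u ()
  split-cost-left {al} {P} {lo = lo} {c} {hi} (eq {k = x} {t} _ _ _ v) l u x<c
    rewrite proj₂ (compare-< x<c) =
    linear (split-cost {P = P} v l u
            ⊹ ≤-reflexive (sym (treeCost-cong {P = P} (above-valid v (ℕₚ.<⇒≤ l) u) (∖-above al x<c) agree-refl))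
            ⊹ ≤-reflexive (sum-split (brick al) lo c hi))
      (solve 7 (λ wl wr w p q q′ r → wl :+ p :+ q′ :+ wr :+ (r :+ q :+ w) := w :+ r :+ (p :+ q :+ q′ :+ (wl :+ wr))) refl
        (weight al lo c) (weight al c hi) (weight al lo hi) (treeCost (al ∖ x) P (below c t) lo c)
        (treeCost (al ∖ x) P (above c t) c hi) (treeCost al P (above c t) c hi) (treeCost (al ∖ x) P t lo hi))
  split-cost-left {al} {P} {lo = lo} {c} {hi} (lt {c = d} {t} {t′} ld du v w) l u d≤c
    rewrite proj₂ (compare-≥ d≤c) with compare d c
  ... | inj₁ d<c =
    linear (split-cost {P = P} w d<c u ⊹ ≤-reflexive (sum-split (brick al) lo c hi))
      (solve 7 (λ wl wr w p q r s → wl :+ (s :+ p) :+ q :+ wr :+ (r :+ w) := w :+ (s :+ r) :+ (p :+ q :+ (wl :+ wr))) refl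
        (weight al lo c) (weight al c hi) (weight al lo hi) (treeCost al P (below c t′) d c)
        (treeCost al P (above c t′) c hi) (treeCost al P t′ d hi) (treeCost al P t lo d))
  -- The cut repeats the root, so the two sides are just the root's subtrees.
  ... | inj₂ c≤d with ℕₚ.≤-antisym d≤c c≤d
  ...   | refl rewrite below-id v ℕₚ.≤-refl | above-id w ℕₚ.≤-refl =
    linear (weight≥0 al (ℕₚ.<⇒≤ ld) ⊹ ≤-reflexive (sum-split (brick al) lo c hi))
      (solve 5 (λ wl wr w p q → p :+ q :+ wr :+ (wl :+ w) := w :+ (p :+ q) :+ (con0 :+ (wl :+ wr))) refl
        (weight al lo c) (weight al c hi) (weight al lo hi) (treeCost al P t lo c) (treeCost al P t′ c hi))

  split-cost-right {al} {P} {c = c} {hi} (lf _ _) l u ()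
  split-cost-right {al} {P} {lo = lo} {c} {hi} (eq {k = x} {t} _ _ _ v) l u c≤x
    rewrite proj₂ (compare-≥ c≤x) =
    linear (split-cost {P = P} v l u
            ⊹ ≤-reflexive (sym (treeCost-cong {P = P} (below-valid v l (ℕₚ.<⇒≤ u)) (∖-below al c≤x) agree-refl))
            ⊹ ≤-reflexive (sum-split (brick al) lo c hi))
      (solve 7 (λ wl wr w p q p′ r → p′ :+ (wr :+ q) :+ wl :+ (r :+ p :+ w) := w :+ r :+ (p :+ q :+ p′ :+ (wl :+ wr))) refl
        (weight al lo c) (weight al c hi) (weight al lo hi) (treeCost (al ∖ x) P (below c t) lo c)
        (treeCost (al ∖ x) P (above c t) c hi) (treeCost al P (below c t) lo c) (treeCost (al ∖ x) P t lo hi))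
  split-cost-right {al} {P} {lo = lo} {c} {hi} (lt {c = d} {t} {t′} ld du v w) l u c≤d
    rewrite proj₂ (compare-≥ c≤d) with compare c d
  ... | inj₁ c<d =
    linear (split-cost {P = P} v l c<d ⊹ ≤-reflexive (sum-split (brick al) lo c hi))
      (solve 7 (λ wl wr w p q r s → p :+ (wr :+ (q :+ s)) :+ wl :+ (r :+ w) := w :+ (r :+ s) :+ (p :+ q :+ (wl :+ wr))) refl
        (weight al lo c) (weight al c hi) (weight al lo hi) (treeCost al P (below c t) lo c)
        (treeCost al P (above c t) c d) (treeCost al P t lo d) (treeCost al P t′ d hi))
  ... | inj₂ d≤c with ℕₚ.≤-antisym d≤c c≤d
  ...   | refl rewrite below-id v ℕₚ.≤-refl | above-id w ℕₚ.≤-refl =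
    linear (weight≥0 al (ℕₚ.<⇒≤ u) ⊹ ≤-reflexive (sum-split (brick al) lo c hi))
      (solve 5 (λ wl wr w p q → p :+ q :+ wl :+ (wr :+ w) := w :+ (p :+ q) :+ (con0 :+ (wl :+ wr))) refl
        (weight al lo c) (weight al c hi) (weight al lo hi) (treeCost al P t lo c) (treeCost al P t′ c hi))

  -- Either every test on the path to brick k lies to the left of k, or some test lies to its right and cutting just
  -- after k saves that test for the part of the leaf below the cut.
  cut-after : ∀ {al P t lo hi k} → Valid al t lo hi → lo ≤ⁿ k → k <ⁿ hi → al k ≡ false →
    above k t ≡ lf ⊎
    (suc k <ⁿ hi × treeCost al P (below (suc k) t) lo (suc k) + treeCost al P (above (suc k) t) (suc k) hi
                   + sum a (leafLo t k lo) (suc k) ≤ treeCost al P t lo hi)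
  cut-after (lf _ _) l u dead = inj₁ refl
  cut-after {al} {P} {lo = lo} {hi} {k} v₀@(eq {k = x} {t} lx xu alive v) l u dead with compare x k
  ... | inj₂ k≤x = inj₂ (ℕₚ.≤-<-trans k<x xu ,
    -- A root right of `k` saves the whole weight before the cut, which includes that part of the
    -- leaf.
    linear (split-cost-right {P = P} v₀ (s≤s l) (ℕₚ.≤-<-trans k<x xu) k<x
            ⊹ ≤-trans (sum-sub a≥0 (proj₁ lb) (ℕₚ.m≤n⇒m≤1+n (proj₂ lb)) ℕₚ.≤-refl) (gaps≤weight al (ℕₚ.m≤n⇒m≤1+n l)))
      (solve 4 (λ x y z w → x :+ y :+ (w :+ z) := w :+ (x :+ z :+ y)) refl
        (treeCost al P (below (suc k) (eq x t)) lo (suc k) + treeCost al P (above (suc k) (eq x t)) (suc k) hi)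
        (sum a (leafLo t k lo) (suc k)) (weight al lo (suc k)) (treeCost al P (eq x t) lo hi)))
    where
    k≢x : k ≢ x
    k≢x refl with trans (sym alive) dead
    ... | ()
    k<x = ℕₚ.≤∧≢⇒< k≤x k≢x
    lb = leafLo-bounds v l
  ... | inj₁ x<k with cut-after {P = P} v l u (∖-false al x dead)
  ...   | inj₁ e = inj₁ e
  ...   | inj₂ (c<hi , save) rewrite proj₂ (compare-< (ℕₚ.m<n⇒m<1+n x<k)) = inj₂ (c<hi ,
    -- A root left of `k` is met on the left side only, where it costs at most its old weight; the
    -- saving found further down is kept.
    linear (save
            ⊹ ≤-reflexive (sym (treeCost-cong {P = P} (above-valid v (ℕₚ.m≤n⇒m≤1+n l) c<hi)
                (∖-above al (ℕₚ.m<n⇒m<1+n x<k)) agree-refl))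
            ⊹ sum-sub (brick≥0 al) (ℕₚ.≤-refl {lo}) (ℕₚ.m≤n⇒m≤1+n l) (ℕₚ.<⇒≤ c<hi))
      (solve 7 (λ wl w p q q′ r s → wl :+ p :+ q′ :+ s :+ (r :+ q :+ w) := w :+ r :+ (p :+ q :+ s :+ q′ :+ wl)) refl
        (weight al lo (suc k)) (weight al lo hi) (treeCost (al ∖ x) P (below (suc k) t) lo (suc k))
        (treeCost (al ∖ x) P (above (suc k) t) (suc k) hi) (treeCost al P (above (suc k) t) (suc k) hi)
        (treeCost (al ∖ x) P t lo hi) (sum a (leafLo t k lo) (suc k))))
  cut-after {al} {P} {lo = lo} {hi} {k} v₀@(lt {c = d} {t} {t′} ld du v w) l u dead with compare k d
  ... | inj₁ k<d = inj₂ (ℕₚ.≤-<-trans k<d du ,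
    linear (split-cost-right {P = P} v₀ (s≤s l) (ℕₚ.≤-<-trans k<d du) k<d
            ⊹ ≤-trans (sum-sub a≥0 (proj₁ lb) (ℕₚ.m≤n⇒m≤1+n (proj₂ lb)) ℕₚ.≤-refl) (gaps≤weight al (ℕₚ.m≤n⇒m≤1+n l)))
      (solve 4 (λ x y z w → x :+ y :+ (w :+ z) := w :+ (x :+ z :+ y)) refl
        (treeCost al P (below (suc k) (lt d t t′)) lo (suc k) + treeCost al P (above (suc k) (lt d t t′)) (suc k) hi)
        (sum a (leafLo t k lo) (suc k)) (weight al lo (suc k)) (treeCost al P (lt d t t′) lo hi)))
    where
    lb = leafLo-bounds v l
  ... | inj₂ d≤k with cut-after {P = P} w d≤k u dead
  ...   | inj₁ e = inj₁ e
  ...   | inj₂ (c<hi , save)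
    rewrite proj₂ (compare-< (s≤s d≤k)) | proj₂ (compare-≥ (ℕₚ.m≤n⇒m≤1+n d≤k)) = inj₂ (c<hi ,
    linear (save ⊹ sum-sub (brick≥0 al) (ℕₚ.≤-refl {lo}) (ℕₚ.m≤n⇒m≤1+n l) (ℕₚ.<⇒≤ c<hi))
      (solve 7 (λ wl w p q r s y → wl :+ (y :+ p) :+ q :+ s :+ (r :+ w) := w :+ (y :+ r) :+ (p :+ q :+ s :+ wl)) refl
        (weight al lo (suc k)) (weight al lo hi) (treeCost al P (below (suc k) t′) d (suc k))
        (treeCost al P (above (suc k) t′) (suc k) hi) (treeCost al P t′ d hi) (sum a (leafLo t′ k d) (suc k))
        (treeCost al P t lo d)))

  -- Bounds for trees that locate every gap

  -- A tested key no longer separates its two neighbouring gaps, so a cut there must be budgeted.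
  -- The brick `lo` is exempt, being a boundary already; accordingly the charges in `treeCost` start
  -- at `suc lo`.
  Cover : (ℕ → Bool) → (ℕ → Bool) → ℕ → ℕ → Set
  Cover P al lo hi = ∀ j → lo <ⁿ j → j <ⁿ hi → al j ≡ false → P j ≡ true

  cover-sub : ∀ {P al lo lo′ hi′ hi} → lo ≤ⁿ lo′ → hi′ ≤ⁿ hi → Cover P al lo hi → Cover P al lo′ hi′
  cover-sub l u h j lj ju = h j (ℕₚ.≤-<-trans l lj) (ℕₚ.<-≤-trans ju u)

  cover-∖ : ∀ {P al lo hi k} → k ≤ⁿ lo → Cover P al lo hi → Cover P (al ∖ k) lo hi
  cover-∖ {al = al} k≤lo h j lj ju e = h j lj ju (trans (sym (∖-other al (ℕₚ.>⇒≢ (ℕₚ.≤-<-trans k≤lo lj)))) e)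

  cover-∪ : ∀ {P al lo hi} k → Cover P al lo hi → Cover (P ∪ k) (al ∖ k) lo hi
  cover-∪ k h j lj ju e with j ≡ᵇ k
  ... | true  = refl
  ... | false = h j lj ju e

  -- The possible bounds x on the cost of a tree that separates all the queries.
  data LocCost : (ℕ → Bool) → ℕ → ℕ → ℚ → Set where
    single : ∀ {al lo} → al lo ≡ false → LocCost al lo (suc lo) 0ℚ
    eq     : ∀ {al k lo hi x} → lo ≤ⁿ k → k <ⁿ hi → al k ≡ true → LocCost (al ∖ k) lo hi x →
             LocCost al lo hi (weight al lo hi + x)
    lt     : ∀ {al c lo hi x y} → lo <ⁿ c → c <ⁿ hi → LocCost al lo c x → LocCost al c hi y →
             LocCost al lo hi (weight al lo hi + (x + y))
    weaken : ∀ {al lo hi x y} → x ≤ y → LocCost al lo hi x → LocCost al lo hi y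

  -- Cut the gaps off one by one from the right. Each cut costs the weight of what is left, at most
  -- that of the whole leaf, which is its charge; no surplus weight is spent.
  locate-leaf : ∀ {al P lo hi} → Valid al lf lo hi → Cover P al lo hi → LocCost al lo hi (treeCost al P lf lo hi)
  locate-leaf {al} {P} {lo} (lf lo<hi dead) = go (ℕₚ.≤⇒≤′ lo<hi) dead
    where
    go : ∀ {hi} → suc lo ℕ.≤′ hi → (∀ j → lo ≤ⁿ j → j <ⁿ hi → al j ≡ false) → Cover P al lo hi →
         LocCost al lo hi (treeCost al P lf lo hi)
    go ℕ.≤′-refl d cov =
      subst (LocCost al lo (suc lo)) (sym (sum-empty (charge P (weight al lo (suc lo))) (suc lo)))
        (single (d lo ℕₚ.≤-refl ℕₚ.≤-refl))
    go (ℕ.≤′-step {n} lo<′n) d cov =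
      weaken bound (lt lo<n ℕₚ.≤-refl (go lo<′n (λ j l u → d j l (ℕₚ.m<n⇒m<1+n u)) (cover-sub ℕₚ.≤-refl (ℕₚ.n≤1+n n) cov))
                                      (single (d n (ℕₚ.<⇒≤ lo<n) ℕₚ.≤-refl)))
      where
      lo<n = ℕₚ.≤′⇒≤ lo<′n
      w  = weight al lo n
      w′ = weight al lo (suc n)
      bound : w′ + (sum (charge P w) (suc lo) n + 0ℚ) ≤ sum (charge P w′) (suc lo) (suc n)
      bound = begin
        w′ + (sum (charge P w) (suc lo) n + 0ℚ)
          ≤⟨ linear (sum-mono lo<n (λ j _ _ → charge-mono P (sum-sub (brick≥0 al) ℕₚ.≤-refl (ℕₚ.<⇒≤ lo<n) (ℕₚ.n≤1+n n)) j))
               (solve 3 (λ w x y → w :+ (x :+ con0) :+ y := y :+ w :+ x) refl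
                 w′ (sum (charge P w) (suc lo) n) (sum (charge P w′) (suc lo) n)) ⟩
        sum (charge P w′) (suc lo) n + w′
          ≡⟨ cong (λ x → sum (charge P w′) (suc lo) n + (if x then w′ else 0ℚ))
               (cov n lo<n ℕₚ.≤-refl (d n (ℕₚ.<⇒≤ lo<n) ℕₚ.≤-refl)) ⟨
        sum (charge P w′) (suc lo) n + charge P w′ n
          ≡⟨ sum-snoc (charge P w′) (suc lo) n ⟨
        sum (charge P w′) (suc lo) (suc n) ∎
        where open ≤-Reasoning

  -- Budgets for the ways of replacing an equality test

  module _ {al P : ℕ → Bool} {k lo hi : ℕ} (lo≤k : lo ≤ⁿ k) (k<hi : k <ⁿ hi) (alive : al k ≡ true) where
    private
      al₁ = al ∖ k
      P₁  = P ∪ k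
      W   = weight al lo hi
      W₁  = weight al₁ lo hi
      Goal : Skeleton → Set
      Goal t = LocCost al lo hi (treeCost al P (eq k t) lo hi + W)
      weights : ∀ c → weight al lo c + weight al c hi ≤ W
      weights c = ≤-reflexive (sum-split (brick al) lo c hi)

    -- For `k` the first brick: keeping the test creates no cut inside the interval, and the surplus
    -- only shrinks by the weight of `k`.
    test-first-key : ∀ t → LocCost al₁ lo hi (treeCost al₁ P t lo hi + W₁) → Goal t
    test-first-key t X = weaken
      (linear (b≥0 k ⊹ ≤-reflexive (weight-∖ lo≤k k<hi alive))
        (solve 4 (λ w c w₁ β → w :+ (c :+ w₁) :+ (β :+ w) := w :+ c :+ w :+ (con0 :+ (w₁ :+ β))) refl
          W (treeCost al₁ P t lo hi) W₁ (b k)))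
      (eq lo≤k k<hi alive X)

    -- The surplus passed on is smaller by `b k`, and this difference pays for the pending cut at
    -- the leaf.
    test-heavy-key : ∀ {t} → Valid al₁ t lo hi → sum a (leafLo t k lo) (leafHi t k hi) ≤ b k →
                     LocCost al₁ lo hi (treeCost al₁ P₁ t lo hi + W₁) → Goal t
    test-heavy-key {t} v heavy X = weaken
      (linear (treeCost-∪ {P = P} v lo≤k k<hi ⊹ heavy ⊹ ≤-reflexive (weight-∖ lo≤k k<hi alive))
        (solve 6 (λ w c c₁ w₁ β ℓ → w :+ (c₁ :+ w₁) :+ (c :+ ℓ :+ β :+ w) := w :+ c :+ w :+ (c₁ :+ ℓ :+ (w₁ :+ β))) refl
          W (treeCost al₁ P t lo hi) (treeCost al₁ P₁ t lo hi) W₁ (b k) (sum a (leafLo t k lo) (leafHi t k hi))))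
      (eq lo≤k k<hi alive X)

    -- `locate-leaf` consumes no surplus, so all of `W` is available for the pending cut at `k`.
    test-last-key : LocCost al₁ lo hi (treeCost al₁ P₁ lf lo hi) → Valid al₁ lf lo hi → Goal lf
    test-last-key X v = weaken
      (linear (treeCost-∪ {P = P} v lo≤k k<hi ⊹ gaps≤weight al (ℕₚ.<⇒≤ (valid-range v)))
        (solve 4 (λ w c c₁ ℓ → w :+ c₁ :+ (c :+ ℓ :+ w) := w :+ c :+ w :+ (c₁ :+ ℓ)) refl
          W (treeCost al₁ P lf lo hi) (treeCost al₁ P₁ lf lo hi) (sum a lo hi)))
      (eq lo≤k k<hi alive X)

    -- The cut takes over the cost of `q = k`. The left share of `W` stays as surplus there, and the
    -- right share pays for asking `q = k` after the cut; the surplus on the right comes from the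
    -- saved root of `t`.
    cut-before : ∀ {t} → lo <ⁿ k → Valid al₁ t lo hi → LeftRoot k t →
      LocCost al lo k (treeCost al P (below k t) lo k + weight al lo k) →
      LocCost al₁ k hi (treeCost al₁ P (above k t) k hi + weight al₁ k hi) → Goal t
    cut-before {t} lo<k v root X Y = weaken
      (linear (split-cost-left {P = P} v lo<k k<hi root
              ⊹ ≤-reflexive (sym (treeCost-cong {P = P} (below-valid v lo<k lo≤hi) (∖-below al ℕₚ.≤-refl) agree-refl))
              ⊹ weights k)
        (solve 8 (λ w wl wr wr₁ cb cb₁ ca c →
            w :+ (cb :+ wl :+ (wr :+ (ca :+ wr₁))) :+ (c :+ cb₁ :+ w) := w :+ c :+ w :+ (cb₁ :+ ca :+ wr₁ :+ cb :+ (wl :+ wr))) refl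
          W (weight al lo k) (weight al k hi) (weight al₁ k hi) (treeCost al P (below k t) lo k)
          (treeCost al₁ P (below k t) lo k) (treeCost al₁ P (above k t) k hi) (treeCost al₁ P t lo hi)))
      (lt lo<k k<hi X (eq ℕₚ.≤-refl k<hi alive Y))
      where lo≤hi = ℕₚ.<⇒≤ k<hi

    -- The left share of `W` pays for `q = k` after the cut. Of the two savings in the hypothesis,
    -- the weight becomes the left surplus and the gap sum pays for the pending cut at `k`.
    cut-after-saving : ∀ {t} → suc k <ⁿ hi → Valid al₁ t lo hi →
      treeCost al₁ P (below (suc k) t) lo (suc k) + treeCost al₁ P (above (suc k) t) (suc k) hi
        + weight al₁ lo (suc k) + sum a (leafLo t k lo) (suc k) ≤ treeCost al₁ P t lo hi →
      LocCost al₁ lo (suc k) (treeCost al₁ P₁ (below (suc k) t) lo (suc k) + weight al₁ lo (suc k)) →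
      LocCost al (suc k) hi (treeCost al P (above (suc k) t) (suc k) hi + weight al (suc k) hi) → Goal t
    cut-after-saving {t} c<hi v save X Y = weaken
      (linear (save
              ⊹ treeCost-∪ {P = P} vb lo≤k ℕₚ.≤-refl
              ⊹ leaf-cut
              ⊹ ≤-reflexive (treeCost-cong {P = P} (valid-cong agree va) (agree-sym agree) agree-refl)
              ⊹ weights (suc k))
        (solve 11 (λ w wl wr wl₁ cb cb₁ ca ca₁ c ℓ ℓ′ →
            w :+ (wl :+ (cb₁ :+ wl₁) :+ (ca :+ wr)) :+ (c :+ (cb :+ ℓ′) :+ ℓ :+ ca₁ :+ w)
              := w :+ c :+ w :+ (cb :+ ca₁ :+ wl₁ :+ ℓ :+ cb₁ :+ ℓ′ :+ ca :+ (wl :+ wr))) refl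
          W (weight al lo (suc k)) (weight al (suc k) hi) (weight al₁ lo (suc k)) (treeCost al₁ P (below (suc k) t) lo (suc k))
          (treeCost al₁ P₁ (below (suc k) t) lo (suc k)) (treeCost al P (above (suc k) t) (suc k) hi)
          (treeCost al₁ P (above (suc k) t) (suc k) hi) (treeCost al₁ P t lo hi) (sum a (leafLo t k lo) (suc k))
          (sum a (leafLo (below (suc k) t) k lo) (leafHi (below (suc k) t) k (suc k)))))
      (lt (s≤s lo≤k) c<hi (eq lo≤k ℕₚ.≤-refl alive X) Y)
      where
      vb = below-valid v (s≤s lo≤k) (ℕₚ.<⇒≤ c<hi)
      va = above-valid v (ℕₚ.m≤n⇒m≤1+n lo≤k) c<hi
      agree = ∖-above al {suc k} {hi} (ℕₚ.≤-refl {suc k})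
      hb = leafHi-bounds vb ℕₚ.≤-refl
      leaf-cut : sum a (leafLo (below (suc k) t) k lo) (leafHi (below (suc k) t) k (suc k)) ≤ sum a (leafLo t k lo) (suc k)
      leaf-cut rewrite leafLo-below t k lo =
        sum-sub a≥0 ℕₚ.≤-refl (ℕₚ.≤-trans (proj₂ (leafLo-bounds v lo≤k)) (ℕₚ.<⇒≤ (proj₁ hb))) (proj₂ hb)

    -- The left side is a leaf and consumes no surplus, so the saved root of `t` pays for the
    -- pending cut at `k`.
    cut-after-first : ∀ {t} → suc k <ⁿ hi → Valid al₁ t lo hi → RightRoot (suc k) t → below (suc k) t ≡ lf →
      LocCost al₁ lo (suc k) (treeCost al₁ P₁ lf lo (suc k)) →
      LocCost al (suc k) hi (treeCost al P (above (suc k) t) (suc k) hi + weight al (suc k) hi) → Goal t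
    cut-after-first {t} c<hi v root e X Y = weaken
      (linear (subst (λ s → treeCost al₁ P s lo (suc k) + treeCost al₁ P (above (suc k) t) (suc k) hi
                              + weight al₁ lo (suc k) ≤ treeCost al₁ P t lo hi)
                e (split-cost-right {P = P} v (s≤s lo≤k) c<hi root)
              ⊹ treeCost-∪ {P = P} (subst (λ s → Valid al₁ s lo (suc k)) e vb) lo≤k ℕₚ.≤-refl
              ⊹ gaps≤weight al₁ (ℕₚ.m≤n⇒m≤1+n lo≤k)
              ⊹ ≤-reflexive (treeCost-cong {P = P} (valid-cong agree va) (agree-sym agree) agree-refl)
              ⊹ weights (suc k))
        (solve 10 (λ w wl wr wl₁ cb cb₁ ca ca₁ c ℓ →
            w :+ (wl :+ cb₁ :+ (ca :+ wr)) :+ (c :+ (cb :+ ℓ) :+ wl₁ :+ ca₁ :+ w)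
              := w :+ c :+ w :+ (cb :+ ca₁ :+ wl₁ :+ cb₁ :+ ℓ :+ ca :+ (wl :+ wr))) refl
          W (weight al lo (suc k)) (weight al (suc k) hi) (weight al₁ lo (suc k)) (treeCost al₁ P lf lo (suc k))
          (treeCost al₁ P₁ lf lo (suc k)) (treeCost al P (above (suc k) t) (suc k) hi)
          (treeCost al₁ P (above (suc k) t) (suc k) hi) (treeCost al₁ P t lo hi) (sum a lo (suc k))))
      (lt (s≤s lo≤k) c<hi (eq lo≤k ℕₚ.≤-refl alive X) Y)
      where
      vb = below-valid v (s≤s lo≤k) (ℕₚ.<⇒≤ c<hi)
      va = above-valid v (ℕₚ.m≤n⇒m≤1+n lo≤k) c<hi
      agree = ∖-above al {suc k} {hi} (ℕₚ.≤-refl {suc k})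

    -- Both equality tests move to the right side, paid for by the right share of `W` and by the old
    -- `q = k₂`. The saved root of `t` pays for the cut pending at `k₂` in the leaf.
    cut-before-two-keys : ∀ {k₂ t} → lo <ⁿ k → k <ⁿ k₂ → k₂ <ⁿ hi → al₁ k₂ ≡ true →
      Valid (al₁ ∖ k₂) t lo hi → LeftRoot k t → above k t ≡ lf →
      LocCost al lo k (treeCost al P (below k t) lo k + weight al lo k) →
      LocCost (al₁ ∖ k₂) k hi (treeCost (al₁ ∖ k₂) (P ∪ k₂) lf k hi) → Goal (eq k₂ t)
    cut-before-two-keys {k₂} {t} lo<k k<k₂ k₂<hi alive₂ v root e X Z = weaken
      (linear (subst (λ s → treeCost al₂ P (below k t) lo k + treeCost al₂ P s k hi + weight al₂ k hi
                              ≤ treeCost al₂ P t lo hi)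
                e (split-cost-left {P = P} v lo<k k<hi root)
              ⊹ treeCost-∪ {P = P} (subst (λ s → Valid al₂ s k hi) e va) (ℕₚ.<⇒≤ k<k₂) k₂<hi
              ⊹ gaps≤weight al₂ (ℕₚ.<⇒≤ k<hi)
              ⊹ ≤-reflexive (sym (treeCost-cong {P = P} vb agree agree-refl))
              ⊹ weights k
              ⊹ sum-sub (brick≥0 al₁) lo≤k (ℕₚ.<⇒≤ k<hi) (ℕₚ.≤-refl {hi}))
        (solve 12 (λ w wl wr wr₁ w₁ wr₂ cb cb₂ z z₂ c ℓ →
            w :+ (cb :+ wl :+ (wr :+ (wr₁ :+ z₂))) :+ (c :+ (z :+ ℓ) :+ wr₂ :+ cb₂ :+ w :+ w₁)
              := w :+ (w₁ :+ c) :+ w :+ (cb₂ :+ z :+ wr₂ :+ z₂ :+ ℓ :+ cb :+ (wl :+ wr) :+ wr₁)) refl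
          W (weight al lo k) (weight al k hi) (weight al₁ k hi) W₁ (weight al₂ k hi)
          (treeCost al P (below k t) lo k) (treeCost al₂ P (below k t) lo k)
          (treeCost al₂ P lf k hi) (treeCost al₂ (P ∪ k₂) lf k hi) (treeCost al₂ P t lo hi) (sum a k hi)))
      (lt lo<k k<hi X (eq ℕₚ.≤-refl k<hi alive (eq (ℕₚ.<⇒≤ k<k₂) k₂<hi alive₂ Z)))
      where
      al₂ = al₁ ∖ k₂
      vb = below-valid v lo<k (ℕₚ.<⇒≤ k<hi)
      va = above-valid v lo≤k k<hi
      agree : Agree al₂ al lo k
      agree j l u = trans (∖-below al₁ (ℕₚ.<⇒≤ k<k₂) j l u) (∖-below al ℕₚ.≤-refl j l u)

    -- The two tests are exchanged: the side beyond `d` saves `q = k`, and in return `k` becomes one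
    -- level deeper.
    cut-at-light-side : ∀ t {d u} → k <ⁿ d → d <ⁿ hi → Valid al₁ u d hi → b k ≤ weight al d hi →
      LocCost al lo d (treeCost al P (eq k t) lo d + weight al lo d) →
      LocCost al d hi (treeCost al P u d hi + weight al d hi) → Goal (lt d t u)
    cut-at-light-side t {d} {u} k<d d<hi v heavy X Y = weaken
      (linear (heavy
              ⊹ ≤-reflexive (sym (weight-∖ lo≤k k<hi alive))
              ⊹ weights d ⊹ weights d
              ⊹ ≤-reflexive (treeCost-cong {P = P} (valid-cong agree v) (agree-sym agree) agree-refl))
        (solve 8 (λ w wa wb w₁ ct cu cu₁ β →
            w :+ (wa :+ ct :+ wa :+ (cu :+ wb)) :+ (wb :+ (w₁ :+ β) :+ w :+ w :+ cu₁)
              := w :+ (w₁ :+ (ct :+ cu₁)) :+ w :+ (β :+ w :+ (wa :+ wb) :+ (wa :+ wb) :+ cu)) refl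
          W (weight al lo d) (weight al d hi) W₁ (treeCost al₁ P t lo d) (treeCost al P u d hi) (treeCost al₁ P u d hi) (b k)))
      (lt (ℕₚ.≤-<-trans lo≤k k<d) d<hi X Y)
      where agree = ∖-above al {d} {hi} k<d

    -- Up to `d` every brick saves one level: before `k` the test at `d`, from `k` on the root of
    -- `t`. These bricks contain the leaf of gap `k`, so the saving covers the surplus for `u`.
    cut-before-light-side : ∀ {d t} u → lo <ⁿ k → k <ⁿ d → d <ⁿ hi → Valid al₁ t lo d → LeftRoot k t → above k t ≡ lf →
      weight al d hi ≤ sum a (leafLo t k lo) (leafHi t k d) →
      LocCost al lo k (treeCost al P (below k t) lo k + weight al lo k) →
      LocCost al₁ k d (treeCost al₁ P lf k d) →
      LocCost al₁ d hi (treeCost al₁ P u d hi + weight al₁ d hi) → Goal (lt d t u)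
    cut-before-light-side {d} {t} u lo<k k<d d<hi v root e light X Z Y = weaken
      (linear (subst (λ s → treeCost al₁ P (below k t) lo k + treeCost al₁ P s k d + weight al₁ k d
                              ≤ treeCost al₁ P t lo d)
                e (split-cost-left {P = P} v lo<k k<d root)
              ⊹ ≤-reflexive (sym (treeCost-cong {P = P} (below-valid v lo<k (ℕₚ.<⇒≤ k<d)) (∖-below al ℕₚ.≤-refl) agree-refl))
              ⊹ weights k
              ⊹ ≤-reflexive (sum-split (brick al₁) lo k hi)
              ⊹ ≤-reflexive (sym (sum-split (brick al₁) lo k d))
              ⊹ side)
        (solve 14 (λ w wl wr wr₁ wl₁ w₁ kd ld wd cb cb₁ z cu c →
            w :+ (cb :+ wl :+ (wr :+ (wr₁ :+ (z :+ (cu :+ wd))))) :+ (c :+ cb₁ :+ w :+ w₁ :+ (wl₁ :+ kd) :+ ld)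
              := w :+ (w₁ :+ (c :+ cu)) :+ w :+ (cb₁ :+ z :+ kd :+ cb :+ (wl :+ wr) :+ (wl₁ :+ wr₁) :+ ld :+ wd)) refl
          W (weight al lo k) (weight al k hi) (weight al₁ k hi) (weight al₁ lo k) W₁ (weight al₁ k d) (weight al₁ lo d)
          (weight al₁ d hi) (treeCost al P (below k t) lo k) (treeCost al₁ P (below k t) lo k) (treeCost al₁ P lf k d)
          (treeCost al₁ P u d hi) (treeCost al₁ P t lo d)))
      (lt lo<k k<hi X (eq ℕₚ.≤-refl k<hi alive (lt k<d d<hi Z Y)))
      where
      lb = leafLo-bounds v lo≤k
      hb = leafHi-bounds v k<d
      side : weight al₁ d hi ≤ weight al₁ lo d
      side = begin
        weight al₁ d hi                              ≡⟨ weight-cong (ℕₚ.<⇒≤ d<hi) (∖-above al k<d) ⟩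
        weight al d hi                               ≤⟨ light ⟩
        sum a (leafLo t k lo) (leafHi t k d)         ≤⟨ sum-sub a≥0 (proj₁ lb) (ℕₚ.≤-trans (proj₂ lb) (ℕₚ.<⇒≤ (proj₁ hb))) (proj₂ hb) ⟩
        sum a lo d                                   ≤⟨ gaps≤weight al₁ (ℕₚ.≤-trans lo≤k (ℕₚ.<⇒≤ k<d)) ⟩
        weight al₁ lo d                              ∎
        where open ≤-Reasoning

  -- The induction on the size of the skeleton

  -- A root right of `k` would survive in `above k t`.
  lf-or-left : ∀ k t → above k t ≡ lf → t ≡ lf ⊎ LeftRoot k t
  lf-or-left k lf e = inj₁ refl
  lf-or-left k (eq x t) e with compare x k
  ... | inj₁ x<k = inj₂ x<k
  lf-or-left k (lt d t u) e with compare k d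
  ... | inj₂ d≤k = inj₂ d≤k

  -- A size bound is used because recursion also goes to restrictions, which need not be subtrees.
  -- The added weight is the surplus that becomes 1 for the whole tree.
  Locatable : ℕ → Set
  Locatable m = ∀ {al P t lo hi} → size t ≤ⁿ m → Valid al t lo hi → Cover P al lo hi →
                LocCost al lo hi (treeCost al P t lo hi + weight al lo hi)

  module _ {m : ℕ} {al P : ℕ → Bool} {k lo hi : ℕ} (ih : Locatable m) (lo<k : lo <ⁿ k) (k<hi : k <ⁿ hi)
           (alive : al k ≡ true) (cov : Cover P al lo hi) where
    private
      al₁  = al ∖ k
      lo≤k = ℕₚ.<⇒≤ lo<k
      k≤hi = ℕₚ.<⇒≤ k<hi
      Goal : Skeleton → Set
      Goal t = LocCost al lo hi (treeCost al P (eq k t) lo hi + weight al lo hi)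

      -- The end `hi′` and the set `al′` are free so that this also serves a subtree below `q = k₂`
      -- or left of a cut at `d`.
      before : ∀ {s al′ hi′} → size s ≤ⁿ m → k ≤ⁿ hi′ → Valid al′ s lo hi′ → Agree al′ al lo k →
               LocCost al lo k (treeCost al P (below k s) lo k + weight al lo k)
      before {s} n k≤hi′ v g = ih (ℕₚ.≤-trans (below-size k s) n) (valid-cong g (below-valid v lo<k k≤hi′))
                                  (cover-sub ℕₚ.≤-refl k≤hi cov)

      from : ∀ {s} → size s ≤ⁿ m → Valid al₁ s lo hi →
             LocCost al₁ k hi (treeCost al₁ P (above k s) k hi + weight al₁ k hi)
      from {s} n v = ih (ℕₚ.≤-trans (above-size k s) n) (above-valid v lo≤k k<hi)
                        (cover-∖ ℕₚ.≤-refl (cover-sub lo≤k ℕₚ.≤-refl cov))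

      upto : ∀ {s} → size s ≤ⁿ m → Valid al₁ s lo hi →
             LocCost al₁ lo (suc k) (treeCost al₁ (P ∪ k) (below (suc k) s) lo (suc k) + weight al₁ lo (suc k))
      upto {s} n v = ih (ℕₚ.≤-trans (below-size (suc k) s) n) (below-valid v (ℕₚ.m<n⇒m<1+n lo<k) k<hi)
                        (cover-sub ℕₚ.≤-refl k<hi (cover-∪ k cov))

      after : ∀ {s} → size s ≤ⁿ m → suc k <ⁿ hi → Valid al₁ s lo hi →
              LocCost al (suc k) hi (treeCost al P (above (suc k) s) (suc k) hi + weight al (suc k) hi)
      after {s} n c<hi v = ih (ℕₚ.≤-trans (above-size (suc k) s) n)
        (valid-cong (∖-above al ℕₚ.≤-refl) (above-valid v (ℕₚ.m≤n⇒m≤1+n lo≤k) c<hi))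
        (cover-sub (ℕₚ.m≤n⇒m≤1+n lo≤k) ℕₚ.≤-refl cov)

    locate-left : ∀ {t} → size t ≤ⁿ m → Valid al₁ t lo hi → LeftRoot k t → Goal t
    locate-left n v root = cut-before {P = P} lo≤k k<hi alive lo<k v root
      (before n k≤hi v (∖-below al ℕₚ.≤-refl)) (from n v)

    locate-first : ∀ {t} → size t ≤ⁿ m → suc k <ⁿ hi → Valid al₁ t lo hi → RightRoot (suc k) t →
                   below (suc k) t ≡ lf → Goal t
    locate-first n c<hi v root e = cut-after-first {P = P} lo≤k k<hi alive c<hi v root e
      (locate-leaf (subst (λ s → Valid al₁ s lo (suc k)) e (below-valid v (ℕₚ.m<n⇒m<1+n lo<k) k<hi))
                   (cover-sub ℕₚ.≤-refl k<hi (cover-∪ k cov)))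
      (after n c<hi v)

    locate-saving : ∀ {t} → size t ≤ⁿ m → suc k <ⁿ hi → Valid al₁ t lo hi →
      treeCost al₁ P (below (suc k) t) lo (suc k) + treeCost al₁ P (above (suc k) t) (suc k) hi
        + weight al₁ lo (suc k) + sum a (leafLo t k lo) (suc k) ≤ treeCost al₁ P t lo hi → Goal t
    locate-saving n c<hi v save = cut-after-saving {P = P} lo≤k k<hi alive c<hi v save (upto n v) (after n c<hi v)

    -- A cut after `k` saves `q = k₂` on its left, and `cut-after` seeks the second saving below
    -- that test. Failing this, `t` is a leaf or its root lies left of `k`.
    locate-key-right : ∀ {k₂ t} → suc (size t) ≤ⁿ m → k <ⁿ k₂ → Valid al₁ (eq k₂ t) lo hi → Goal (eq k₂ t)
    locate-key-right {k₂} {t} n k<k₂ v₁@(eq _ k₂<hi alive₂ v)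
      with cut-after {P = P} v lo≤k k<hi (∖-false al₁ k₂ (∖-same al k))
    ... | inj₂ (c<hi , save) = locate-saving n c<hi v₁ save₁
      where
      c = suc k
      save₁ : treeCost al₁ P (below c (eq k₂ t)) lo c + treeCost al₁ P (above c (eq k₂ t)) c hi
                + weight al₁ lo c + sum a (leafLo t k lo) c ≤ treeCost al₁ P (eq k₂ t) lo hi
      save₁ rewrite proj₂ (compare-≥ k<k₂) =
        linear (save
                ⊹ ≤-reflexive (sym (treeCost-cong {P = P} (below-valid v (ℕₚ.m<n⇒m<1+n lo<k) (ℕₚ.<⇒≤ c<hi))
                    (∖-below al₁ k<k₂) agree-refl))
                ⊹ ≤-reflexive (sum-split (brick al₁) lo c hi))
          (solve 8 (λ wl wr w cb cb₁ ca ℓ r → cb₁ :+ (wr :+ ca) :+ wl :+ ℓ :+ (r :+ cb :+ w)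
                                              := w :+ r :+ (cb :+ ca :+ ℓ :+ cb₁ :+ (wl :+ wr))) refl
            (weight al₁ lo c) (weight al₁ c hi) (weight al₁ lo hi) (treeCost (al₁ ∖ k₂) P (below c t) lo c)
            (treeCost al₁ P (below c t) lo c) (treeCost (al₁ ∖ k₂) P (above c t) c hi) (sum a (leafLo t k lo) c)
            (treeCost (al₁ ∖ k₂) P t lo hi))
    ... | inj₁ e with lf-or-left k t e
    ...   | inj₁ refl = locate-first n (ℕₚ.≤-<-trans k<k₂ k₂<hi) v₁ k<k₂ (below-lf k<k₂)
      where
      below-lf : ∀ {x} → suc k ≤ⁿ x → below (suc k) (eq x lf) ≡ lf
      below-lf k<x rewrite proj₂ (compare-≥ k<x) = refl
    ...   | inj₂ root = cut-before-two-keys {P = P} lo≤k k<hi alive lo<k k<k₂ k₂<hi alive₂ v root e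
      (before (ℕₚ.<⇒≤ n) k≤hi v (λ j l u → trans (∖-below al₁ (ℕₚ.<⇒≤ k<k₂) j l u) (∖-below al ℕₚ.≤-refl j l u)))
      (locate-leaf (subst (λ s → Valid (al₁ ∖ k₂) s k hi) e (above-valid v lo≤k k<hi))
                   (cover-∪ k₂ (cover-∖ ℕₚ.≤-refl (cover-sub lo≤k ℕₚ.≤-refl cov))))

    locate-cut-right : ∀ {d t u} → suc (size t +ⁿ size u) ≤ⁿ m → k <ⁿ d → Valid al₁ (lt d t u) lo hi → Goal (lt d t u)
    locate-cut-right {d} {t} {u} n k<d v₁@(lt lo<d d<hi v w) with cut-after {P = P} v lo≤k k<d (∖-same al k)
    ... | inj₂ (c<d , save) = locate-saving n (ℕₚ.<-trans c<d d<hi) v₁ save₁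
      where
      c = suc k
      save₁ : treeCost al₁ P (below c (lt d t u)) lo c + treeCost al₁ P (above c (lt d t u)) c hi
                + weight al₁ lo c + sum a (leafLo (lt d t u) k lo) c ≤ treeCost al₁ P (lt d t u) lo hi
      save₁ rewrite proj₂ (compare-≥ k<d) | proj₂ (compare-< c<d) | proj₂ (compare-< k<d) =
        linear (save ⊹ ≤-reflexive (sum-split (brick al₁) lo c hi))
          (solve 8 (λ wl wr w cb ca ℓ r s → cb :+ (wr :+ (ca :+ s)) :+ wl :+ ℓ :+ (r :+ w)
                                              := w :+ (r :+ s) :+ (cb :+ ca :+ ℓ :+ (wl :+ wr))) refl
            (weight al₁ lo c) (weight al₁ c hi) (weight al₁ lo hi) (treeCost al₁ P (below c t) lo c)
            (treeCost al₁ P (above c t) c d) (sum a (leafLo t k lo) c) (treeCost al₁ P t lo d) (treeCost al₁ P u d hi))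
    ... | inj₁ e with lf-or-left k t e
    ...   | inj₁ refl = locate-first n (ℕₚ.≤-<-trans k<d d<hi) v₁ k<d (below-lf k<d)
      where
      below-lf : ∀ {x} → suc k ≤ⁿ x → below (suc k) (lt x lf u) ≡ lf
      below-lf k<x rewrite proj₂ (compare-≥ k<x) = refl
    -- In the cycle key ≤ far side ≤ leaf ≤ key at least one inequality holds: if neither comparison
    -- with `b k` gives it, the middle one follows by transitivity.
    ...   | inj₂ root with ≤-total (b k) (weight al d hi) | ≤-total (sum a (leafLo t k lo) (leafHi t k d)) (b k)
    ...     | inj₁ b≤ | _ = cut-at-light-side {P = P} lo≤k k<hi alive t k<d d<hi w b≤
      (ih (ℕₚ.≤-trans (s≤s (ℕₚ.m≤m+n (size t) (size u))) n) (eq lo≤k k<d alive v) (cover-sub ℕₚ.≤-refl (ℕₚ.<⇒≤ d<hi) cov))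
      (ih (ℕₚ.≤-trans (ℕₚ.m≤n⇒m≤1+n (ℕₚ.m≤n+m (size u) (size t))) n) (valid-cong (∖-above al k<d) w)
          (cover-sub (ℕₚ.<⇒≤ lo<d) ℕₚ.≤-refl cov))
    ...     | inj₂ _ | inj₁ leaf≤ = test-heavy-key {P = P} lo≤k k<hi alive v₁ leaf≤₁ (ih n v₁ (cover-∪ k cov))
      where
      leaf≤₁ : sum a (leafLo (lt d t u) k lo) (leafHi (lt d t u) k hi) ≤ b k
      leaf≤₁ rewrite proj₂ (compare-< k<d) = leaf≤
    ...     | inj₂ ≤b | inj₂ b≤leaf = cut-before-light-side {P = P} lo≤k k<hi alive u lo<k k<d d<hi v root e (≤-trans ≤b b≤leaf)
      (before (ℕₚ.≤-trans (ℕₚ.m≤n⇒m≤1+n (ℕₚ.m≤m+n (size t) (size u))) n) (ℕₚ.<⇒≤ k<d) v (∖-below al ℕₚ.≤-refl))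
      (locate-leaf (subst (λ s → Valid al₁ s k d) e (above-valid v lo≤k k<d))
                   (cover-∖ ℕₚ.≤-refl (cover-sub lo≤k (ℕₚ.<⇒≤ d<hi) cov)))
      (ih (ℕₚ.≤-trans (ℕₚ.m≤n⇒m≤1+n (ℕₚ.m≤n+m (size u) (size t))) n) w
          (cover-∖ (ℕₚ.<⇒≤ k<d) (cover-sub (ℕₚ.<⇒≤ lo<d) ℕₚ.≤-refl cov)))

    locate-eq : ∀ {t} → size t ≤ⁿ m → Valid al₁ t lo hi → Goal t
    locate-eq {lf} n v = test-last-key {P = P} lo≤k k<hi alive (locate-leaf v (cover-∪ k cov)) v
    locate-eq {eq k₂ t} n v@(eq _ _ alive₂ _) with compare k₂ k
    ... | inj₁ k₂<k = locate-left n v k₂<k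
    ... | inj₂ k≤k₂ = locate-key-right n (ℕₚ.≤∧≢⇒< k≤k₂ distinct) v
      where
      distinct : k ≢ k₂
      distinct refl with trans (sym alive₂) (∖-same al k)
      ... | ()
    locate-eq {lt d t u} n v with compare k d
    ... | inj₁ k<d = locate-cut-right n k<d v
    ... | inj₂ d≤k = locate-left n v d≤k

  locate : ∀ m → Locatable m
  locate m {al} {P} {lf} {lo} {hi} _ v@(lf l _) cov = weaken
    (linear (weight≥0 al (ℕₚ.<⇒≤ l))
      (solve 2 (λ c w → c :+ w := c :+ w :+ con0) refl (treeCost al P lf lo hi) (weight al lo hi)))
    (locate-leaf v cov)
  locate (suc m) {al} {P} {lt c t u} {lo} {hi} (s≤s n) (lt l h v w) cov = weaken
    -- An inequality test is kept, and its two sides share the surplus.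
    (linear (≤-reflexive (sum-split (brick al) lo c hi))
      (solve 5 (λ w wl wr ct cu → w :+ (ct :+ wl :+ (cu :+ wr)) :+ w := w :+ (ct :+ cu) :+ w :+ (wl :+ wr)) refl
        (weight al lo hi) (weight al lo c) (weight al c hi) (treeCost al P t lo c) (treeCost al P u c hi)))
    (lt l h (locate m (ℕₚ.m+n≤o⇒m≤o (size t) n) v (cover-sub ℕₚ.≤-refl (ℕₚ.<⇒≤ h) cov))
            (locate m (ℕₚ.m+n≤o⇒n≤o (size t) n) w (cover-sub (ℕₚ.<⇒≤ l) ℕₚ.≤-refl cov)))
  -- Only for `lo < k` does the interval contain a gap left of `k`, from which gap `k` must be cut.
  locate (suc m) {al} {P} {eq k t} {lo} (s≤s n) (eq lo≤k k<hi alive v) cov with compare lo k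
  ... | inj₁ lo<k = locate-eq {P = P} (locate m) lo<k k<hi alive cov n v
  ... | inj₂ k≤lo = test-first-key {P = P} lo≤k k<hi alive t (locate m n v (cover-∖ k≤lo cov))

  -- From search trees to skeletons and back

  module _ {n : ℕ} where
    module _ {L : Set} where

      density : Tree n L → (ℕ → Bool) → ℕ → ℚ
      density T al j = share (al j) (a j) (b j) (gapDepth T j) (keyDepth T j)

      density≥0 : ∀ T al j → 0ℚ ≤ density T al j
      density≥0 T al j = share≥0 (al j) (gapDepth T j) (keyDepth T j) (a≥0 j) (b≥0 j)

      -- Only an inequality, because the yes-branch may contain further tests, which the skeleton
      -- drops.
      density-eq : ∀ k t u al j → brick al j + density u (al ∖ keyNumber k) j ≤ density (node eqT k t u) al j
      density-eq k t u al j = go (j ≡ᵇ keyNumber k)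
        where
        go : ∀ h → brick al j + share (if h then false else al j) (a j) (b j) (gapDepth u j) (keyDepth u j)
                   ≤ share (al j) (a j) (b j) (suc (gapDepth u j)) (suc (if h then keyDepth t j else keyDepth u j))
        go true  = ≤-trans (+-monoʳ-≤ (brick al j) (share-drop (al j) (a j) (gapDepth u j) (keyDepth u j) (keyDepth t j) (b≥0 j)))
                           (≤-reflexive (sym (share-suc (al j) (a j) (b j) (gapDepth u j) (keyDepth t j))))
        go false = ≤-reflexive (sym (share-suc (al j) (a j) (b j) (gapDepth u j) (keyDepth u j)))

      density-eq-leaf : ∀ k l u al j → density (node eqT k (leaf l) u) al j ≡ brick al j + density u (al ∖ keyNumber k) j
      density-eq-leaf k l u al j = go (j ≡ᵇ keyNumber k)
        where
        go : ∀ h → share (al j) (a j) (b j) (suc (gapDepth u j)) (suc (if h then 0 else keyDepth u j))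
                   ≡ brick al j + share (if h then false else al j) (a j) (b j) (gapDepth u j) (keyDepth u j)
        go true  = trans (share-suc (al j) (a j) (b j) (gapDepth u j) 0)
                         (cong (brick al j +_) (share-zero (al j) (a j) (b j) (gapDepth u j) (keyDepth u j)))
        go false = share-suc (al j) (a j) (b j) (gapDepth u j) (keyDepth u j)

      -- Unless its live key is the one tested, the whole brick goes on to `u`; a dead key
      -- contributes nothing in either tree.
      density-skip : ∀ k t u al j → (al j ≡ true → j ≢ keyNumber k) → density u al j ≤ density (node eqT k t u) al j
      density-skip k t u al j off = go (al j) (λ e → ≢⇒≡ᵇ-false j (keyNumber k) (off e))
        where
        d = gapDepth u j
        e = if j ≡ᵇ keyNumber k then keyDepth t j else keyDepth u j
        go : ∀ x → (x ≡ true → (j ≡ᵇ keyNumber k) ≡ false) →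
             share x (a j) (b j) d (keyDepth u j) ≤ share x (a j) (b j) (suc d) (suc e)
        go true  miss = subst (λ z → share true (a j) (b j) d (keyDepth u j) ≤ share true (a j) (b j) (suc d) (suc z))
          (cong (λ h → if h then keyDepth t j else keyDepth u j) (sym (miss refl)))
          (share-mono true d (keyDepth u j) (a≥0 j) (b≥0 j))
        go false _    = share-mono false d e (a≥0 j) (b≥0 j)

      density-yes : ∀ k t u al j → j <ⁿ keyNumber k → density (node ltT k t u) al j ≡ brick al j + density t al j
      density-yes k t u al j j<k = trans
        (cong₂ (share (al j) (a j) (b j))
          (cong (suc ∘ [ const (gapDepth t j) , const (gapDepth u j) ]′) (proj₂ (compare-< j<k)))
          (cong (suc ∘ [ const (keyDepth t j) , const (keyDepth u j) ]′) (proj₂ (compare-< j<k))))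
        (share-suc (al j) (a j) (b j) (gapDepth t j) (keyDepth t j))

      density-no : ∀ k t u al j → keyNumber k ≤ⁿ j → density (node ltT k t u) al j ≡ brick al j + density u al j
      density-no k t u al j k≤j = trans
        (cong₂ (share (al j) (a j) (b j))
          (cong (suc ∘ [ const (gapDepth t j) , const (gapDepth u j) ]′) (proj₂ (compare-≥ k≤j)))
          (cong (suc ∘ [ const (keyDepth t j) , const (keyDepth u j) ]′) (proj₂ (compare-≥ k≤j))))
        (share-suc (al j) (a j) (b j) (gapDepth u j) (keyDepth u j))

      expected : Tree n L → (ℕ → Bool) → ℕ → ℕ → ℚ
      expected T al = sum (density T al)

      expected-eq : ∀ k t u al {lo hi} → lo ≤ⁿ hi →
                    weight al lo hi + expected u (al ∖ keyNumber k) lo hi ≤ expected (node eqT k t u) al lo hi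
      expected-eq k t u al {lo} {hi} l = ≤-trans (≤-reflexive (sym (sum-+ (brick al) (density u (al ∖ keyNumber k)) lo hi)))
        (sum-mono l (λ j _ _ → density-eq k t u al j))

      expected-eq-leaf : ∀ k l u al {lo hi} → lo ≤ⁿ hi →
        expected (node eqT k (leaf l) u) al lo hi ≡ weight al lo hi + expected u (al ∖ keyNumber k) lo hi
      expected-eq-leaf k l u al {lo} {hi} h = trans (sum-cong h (λ j _ _ → density-eq-leaf k l u al j))
        (sum-+ (brick al) (density u (al ∖ keyNumber k)) lo hi)

      expected-yes : ∀ k t u al {lo hi} → lo ≤ⁿ hi → hi ≤ⁿ keyNumber k →
                     expected (node ltT k t u) al lo hi ≡ weight al lo hi + expected t al lo hi
      expected-yes k t u al {lo} {hi} l h =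
        trans (sum-cong l (λ j _ j<hi → density-yes k t u al j (ℕₚ.<-≤-trans j<hi h))) (sum-+ (brick al) (density t al) lo hi)

      expected-no : ∀ k t u al {lo hi} → lo ≤ⁿ hi → keyNumber k ≤ⁿ lo →
                    expected (node ltT k t u) al lo hi ≡ weight al lo hi + expected u al lo hi
      expected-no k t u al {lo} {hi} l h =
        trans (sum-cong l (λ j lo≤j _ → density-no k t u al j (ℕₚ.≤-trans h lo≤j))) (sum-+ (brick al) (density u al) lo hi)

      expected-lt : ∀ k t u al {lo hi} → lo ≤ⁿ keyNumber k → keyNumber k ≤ⁿ hi →
        expected (node ltT k t u) al lo hi ≡
        weight al lo hi + (expected t al lo (keyNumber k) + expected u al (keyNumber k) hi)
      expected-lt k t u al {lo} {hi} l h = begin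
        expected T al lo hi                                       ≡⟨ sum-split (density T al) lo c hi ⟨
        expected T al lo c + expected T al c hi
          ≡⟨ cong₂ _+_ (expected-yes k t u al l ℕₚ.≤-refl) (expected-no k t u al h ℕₚ.≤-refl) ⟩
        weight al lo c + expected t al lo c + (weight al c hi + expected u al c hi)
          ≡⟨ solve 4 (λ x y z w → x :+ y :+ (z :+ w) := x :+ z :+ (y :+ w)) refl
               (weight al lo c) (expected t al lo c) (weight al c hi) (expected u al c hi) ⟩
        weight al lo c + weight al c hi + (expected t al lo c + expected u al c hi)
          ≡⟨ cong (_+ (expected t al lo c + expected u al c hi)) (sum-split (brick al) lo c hi) ⟩
        weight al lo hi + (expected t al lo c + expected u al c hi) ∎
        where
        open ≡-Reasoning
        c = keyNumber k
        T = node ltT k t u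

      -- Correctness for the queries that reach the tree. The label function `f` is `nilLabel` for
      -- the given tree and the identity for the constructed one.
      Labels : (Query n → L) → Tree n L → (ℕ → Bool) → ℕ → ℕ → Set
      Labels f T al lo hi =
        (∀ i → lo ≤ⁿ toℕ i → toℕ i <ⁿ hi → search T (gap i) ≡ f (gap i)) ×
        (∀ i → lo ≤ⁿ keyNumber i → keyNumber i <ⁿ hi → al (keyNumber i) ≡ true → search T (key i) ≡ f (key i))

    numbered-key : ∀ {i j} → i <ⁿ j → j <ⁿ suc n → ∃ λ (k : Fin n) → keyNumber k ≡ j
    numbered-key {j = suc j} _ (s≤s j<n) = fromℕ< j<n , cong suc (toℕ-fromℕ< j<n)

    live-key : ∀ {al : ℕ → Bool} {j} → al 0 ≡ false → j <ⁿ suc n → al j ≡ true → ∃ λ (k : Fin n) → keyNumber k ≡ j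
    live-key {j = zero}  dead₀ _ e with trans (sym dead₀) e
    ... | ()
    live-key {j = suc j} dead₀ j<n e = numbered-key z<s j<n

    lt-gap : ∀ {k : Fin n} {i : Fin (suc n)} → toℕ i <ⁿ keyNumber k → answer ltT k (gap i) ≡ true
    lt-gap {k} {i} h = trans (answer-lt-gap k i) (cong [ const true , const false ]′ (proj₂ (compare-< h)))

    ge-gap : ∀ {k : Fin n} {i : Fin (suc n)} → keyNumber k ≤ⁿ toℕ i → answer ltT k (gap i) ≡ false
    ge-gap {k} {i} h = trans (answer-lt-gap k i) (cong [ const true , const false ]′ (proj₂ (compare-≥ h)))

    lt-key : ∀ {k i : Fin n} → keyNumber i <ⁿ keyNumber k → answer ltT k (key i) ≡ true
    lt-key {k} {i} h = trans (answer-lt-key k i) (cong [ const true , const false ]′ (proj₂ (compare-< h)))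

    ge-key : ∀ {k i : Fin n} → keyNumber k ≤ⁿ keyNumber i → answer ltT k (key i) ≡ false
    ge-key {k} {i} h = trans (answer-lt-key k i) (cong [ const true , const false ]′ (proj₂ (compare-≥ h)))

    labels-yes : ∀ {L} (f : Query n → L) k t u {al lo hi hi′} → hi′ ≤ⁿ hi → hi′ ≤ⁿ keyNumber k →
                 Labels f (node ltT k t u) al lo hi → Labels f t al lo hi′
    labels-yes f k t u h h′ (g , κ) =
      (λ i l r → trans (sym (search-yes ltT k t u (lt-gap (ℕₚ.<-≤-trans r h′)))) (g i l (ℕₚ.<-≤-trans r h))) ,
      (λ i l r e → trans (sym (search-yes ltT k t u (lt-key (ℕₚ.<-≤-trans r h′)))) (κ i l (ℕₚ.<-≤-trans r h) e))

    labels-no : ∀ {L} (f : Query n → L) k t u {al lo lo′ hi} → lo ≤ⁿ lo′ → keyNumber k ≤ⁿ lo′ →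
                Labels f (node ltT k t u) al lo hi → Labels f u al lo′ hi
    labels-no f k t u h h′ (g , κ) =
      (λ i l r → trans (sym (search-no ltT k t u (ge-gap (ℕₚ.≤-trans h′ l)))) (g i (ℕₚ.≤-trans h l) r)) ,
      (λ i l r e → trans (sym (search-no ltT k t u (ge-key (ℕₚ.≤-trans h′ l)))) (κ i (ℕₚ.≤-trans h l) r e))

    labels-miss : ∀ {L} (f : Query n → L) k t u {al al′ lo hi} →
      (∀ j → lo ≤ⁿ j → j <ⁿ hi → al′ j ≡ true → j ≢ keyNumber k × al j ≡ true) →
      Labels f (node eqT k t u) al lo hi → Labels f u al′ lo hi
    labels-miss f k t u h (g , κ) = g , λ i l r e →
      trans (sym (search-no eqT k t u (answer-eq-miss (proj₁ (h (keyNumber i) l r e))))) (κ i l r (proj₂ (h (keyNumber i) l r e)))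

    Pruned : Tree-nil n → (ℕ → Bool) → ℕ → ℕ → Set
    Pruned T al lo hi = Σ Skeleton λ t → Valid al t lo hi × treeCost al (const false) t lo hi ≤ expected T al lo hi

    -- Tests decided on the interval and tests of dead keys are skipped, which only lowers depths.
    -- No cut is pending yet, so leaves cost nothing.
    prune : ∀ T al lo hi → lo <ⁿ hi → hi ≤ⁿ suc n → al 0 ≡ false → Labels nilLabel T al lo hi → Pruned T al lo hi
    prune T@(leaf l) al lo hi lo<hi hi≤ dead₀ (g , κ) =
      lf , lf lo<hi dead ,
      subst (_≤ expected T al lo hi) (sym (sum-zero (suc lo) hi)) (sum-nonneg (ℕₚ.<⇒≤ lo<hi) (density≥0 T al))
      where
      dead : ∀ j → lo ≤ⁿ j → j <ⁿ hi → al j ≡ false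
      dead j lo≤j j<hi with al j in e
      ... | false = refl
      ... | true with live-key {al} dead₀ (ℕₚ.<-≤-trans j<hi hi≤) e
      -- `Fin.suc i` is the gap in the brick of key `i`; one leaf cannot carry the labels of both.
      ...   | i , refl with trans (sym (g (Fin.suc i) lo≤j j<hi)) (κ i lo≤j j<hi e)
      ...     | ()
    prune T@(node eqT k t u) al lo hi lo<hi hi≤ dead₀ lab = decide (compare c lo) (compare c hi) (al c) refl
      where
      c = keyNumber k
      skip : (∀ j → lo ≤ⁿ j → j <ⁿ hi → al j ≡ true → j ≢ c) → Pruned T al lo hi
      skip off = lift (prune u al lo hi lo<hi hi≤ dead₀ (labels-miss nilLabel k t u {al} {al} (λ j l r e → off j l r e , e) lab))
        where
        lift : Pruned u al lo hi → Pruned T al lo hi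
        lift (s , v , le) = s , v , ≤-trans le (sum-mono (ℕₚ.<⇒≤ lo<hi) (λ j l r → density-skip k t u al j (off j l r)))
      decide : (c <ⁿ lo) ⊎ (lo ≤ⁿ c) → (c <ⁿ hi) ⊎ (hi ≤ⁿ c) → ∀ x → al c ≡ x → Pruned T al lo hi
      decide (inj₁ c<lo) _ _ _ = skip (λ j l _ _ → ℕₚ.>⇒≢ (ℕₚ.<-≤-trans c<lo l))
      decide _ (inj₂ hi≤c) _ _ = skip (λ j _ r _ → ℕₚ.<⇒≢ (ℕₚ.<-≤-trans r hi≤c))
      decide _ _ false e = skip off
        where
        off : ∀ j → lo ≤ⁿ j → j <ⁿ hi → al j ≡ true → j ≢ c
        off _ _ _ e′ refl with trans (sym e) e′
        ... | ()
      decide (inj₂ lo≤c) (inj₁ c<hi) true e =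
        lift (prune u (al ∖ c) lo hi lo<hi hi≤ (∖-false al c dead₀) (labels-miss nilLabel k t u {al} {al ∖ c} live lab))
        where
        lift : Pruned u (al ∖ c) lo hi → Pruned T al lo hi
        lift (s , v , le) = eq c s , eq lo≤c c<hi e v ,
          ≤-trans (+-monoʳ-≤ (weight al lo hi) le) (expected-eq k t u al (ℕₚ.<⇒≤ lo<hi))
        live : ∀ j → lo ≤ⁿ j → j <ⁿ hi → (al ∖ c) j ≡ true → j ≢ c × al j ≡ true
        live j _ _ e′ with j ℕ.≟ c
        ... | yes refl with trans (sym (∖-same al j)) e′
        ...   | ()
        live j _ _ e′ | no j≢c = j≢c , trans (sym (∖-other al j≢c)) e′
    prune T@(node ltT k t u) al lo hi lo<hi hi≤ dead₀ lab = decide (compare lo c) (compare c hi)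
      where
      c = keyNumber k
      lo≤hi = ℕₚ.<⇒≤ lo<hi
      shallower : ∀ {x y} → y ≤ x → y ≤ weight al lo hi + x
      shallower {x} {y} h = linear (weight≥0 al lo≤hi ⊹ h)
        (solve 3 (λ w x y → y :+ (w :+ x) := w :+ x :+ (con0 :+ y)) refl (weight al lo hi) x y)
      decide : (lo <ⁿ c) ⊎ (c ≤ⁿ lo) → (c <ⁿ hi) ⊎ (hi ≤ⁿ c) → Pruned T al lo hi
      decide (inj₂ c≤lo) _ = lift (prune u al lo hi lo<hi hi≤ dead₀ (labels-no nilLabel k t u {al} ℕₚ.≤-refl c≤lo lab))
        where
        lift : Pruned u al lo hi → Pruned T al lo hi
        lift (s , v , le) = s , v , ≤-trans (shallower le) (≤-reflexive (sym (expected-no k t u al lo≤hi c≤lo)))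
      decide (inj₁ _) (inj₂ hi≤c) = lift (prune t al lo hi lo<hi hi≤ dead₀ (labels-yes nilLabel k t u {al} ℕₚ.≤-refl hi≤c lab))
        where
        lift : Pruned t al lo hi → Pruned T al lo hi
        lift (s , v , le) = s , v , ≤-trans (shallower le) (≤-reflexive (sym (expected-yes k t u al lo≤hi hi≤c)))
      decide (inj₁ lo<c) (inj₁ c<hi) = join
        (prune t al lo c lo<c (ℕₚ.≤-trans (ℕₚ.<⇒≤ c<hi) hi≤) dead₀ (labels-yes nilLabel k t u {al} (ℕₚ.<⇒≤ c<hi) ℕₚ.≤-refl lab))
        (prune u al c hi c<hi hi≤ dead₀ (labels-no nilLabel k t u {al} (ℕₚ.<⇒≤ lo<c) ℕₚ.≤-refl lab))
        where
        join : Pruned t al lo c → Pruned u al c hi → Pruned T al lo hi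
        join (s , v , le) (s′ , v′ , le′) = lt c s s′ , lt lo<c c<hi v v′ ,
          ≤-trans (+-monoʳ-≤ (weight al lo hi) (le ⊹ le′)) (≤-reflexive (sym (expected-lt k t u al (ℕₚ.<⇒≤ lo<c) (ℕₚ.<⇒≤ c<hi))))

    Realized : (ℕ → Bool) → ℕ → ℕ → ℚ → Set
    Realized al lo hi x = Σ (Tree-loc n) λ T → Labels (λ q → q) T al lo hi × expected T al lo hi ≤ x

    -- A derivation of `LocCost` is the shape of a tree; its leaves are labelled by the tested key
    -- or by the one remaining gap.
    realize : ∀ {al lo hi x} → LocCost al lo hi x → hi ≤ⁿ suc n → al 0 ≡ false → Realized al lo hi x
    realize {al} {lo} (single dead) hi≤ dead₀ = T , (labels-gap , labels-key) , ≤-reflexive zero-cost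
      where
      T : Tree-loc n
      T = leaf (gap (fromℕ< hi≤))
      labels-gap : ∀ i → lo ≤ⁿ toℕ i → toℕ i <ⁿ suc lo → gap (fromℕ< hi≤) ≡ gap i
      labels-gap i l (s≤s r) = cong gap (toℕ-injective (trans (toℕ-fromℕ< hi≤) (ℕₚ.≤-antisym l r)))
      labels-key : ∀ i → lo ≤ⁿ keyNumber i → keyNumber i <ⁿ suc lo → al (keyNumber i) ≡ true → gap (fromℕ< hi≤) ≡ key i
      labels-key i l (s≤s r) e with ℕₚ.≤-antisym l r
      ... | refl with trans (sym dead) e
      ...   | ()
      zero-cost : expected T al lo (suc lo) ≡ 0ℚ
      zero-cost = trans (sum-one (density T al) lo)
        (trans (cong (λ x → a lo * ℕ→ℚ 0 + (if x then b lo * ℕ→ℚ 0 else 0ℚ)) dead)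
               (trans (+-identityʳ (a lo * ℕ→ℚ 0)) (*-zeroʳ (a lo))))
    realize {al} {lo} {hi} (eq {k = c} {x = x} lo≤c c<hi alive X) hi≤ dead₀ =
      graft (live-key {al} dead₀ (ℕₚ.<-≤-trans c<hi hi≤) alive) (realize X hi≤ (∖-false al c dead₀))
      where
      graft : (∃ λ k → keyNumber k ≡ c) → Realized (al ∖ c) lo hi x → Realized al lo hi (weight al lo hi + x)
      graft (k , refl) (U , (g , κ) , le) = node eqT k (leaf (key k)) U , (g , labels-key) ,
        ≤-trans (≤-reflexive (expected-eq-leaf k (key k) U al (ℕₚ.≤-trans lo≤c (ℕₚ.<⇒≤ c<hi)))) (+-monoʳ-≤ (weight al lo hi) le)
        where
        labels-key : ∀ i → lo ≤ⁿ keyNumber i → keyNumber i <ⁿ hi → al (keyNumber i) ≡ true →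
                     search (node eqT k (leaf (key k)) U) (key i) ≡ key i
        labels-key i l r e with keyNumber i ℕ.≟ keyNumber k
        ... | yes i≡k with toℕ-injective (ℕₚ.suc-injective i≡k)
        ...   | refl = search-yes eqT k (leaf (key k)) U (answer-eq-hit k)
        labels-key i l r e | no i≢k =
          trans (search-no eqT k (leaf (key k)) U (answer-eq-miss i≢k)) (κ i l r (trans (∖-other al i≢k) e))
    realize {al} {lo} {hi} (lt {c = c} {x = x} {y} lo<c c<hi X Y) hi≤ dead₀ =
      graft (numbered-key lo<c (ℕₚ.<-≤-trans c<hi hi≤)) (realize X (ℕₚ.≤-trans (ℕₚ.<⇒≤ c<hi) hi≤) dead₀) (realize Y hi≤ dead₀)
      where
      graft : (∃ λ k → keyNumber k ≡ c) → Realized al lo c x → Realized al c hi y →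
              Realized al lo hi (weight al lo hi + (x + y))
      graft (k , refl) (T , (g , κ) , le) (U , (g′ , κ′) , le′) = node ltT k T U , (labels-gap , labels-key) ,
        ≤-trans (≤-reflexive (expected-lt k T U al (ℕₚ.<⇒≤ lo<c) (ℕₚ.<⇒≤ c<hi))) (+-monoʳ-≤ (weight al lo hi) (le ⊹ le′))
        where
        labels-gap : ∀ i → lo ≤ⁿ toℕ i → toℕ i <ⁿ hi → search (node ltT k T U) (gap i) ≡ gap i
        labels-gap i l r = [ (λ i<c → trans (search-yes ltT k T U (lt-gap i<c)) (g i l i<c))
                           , (λ c≤i → trans (search-no ltT k T U (ge-gap c≤i)) (g′ i c≤i r)) ]′ (compare (toℕ i) (keyNumber k))
        labels-key : ∀ i → lo ≤ⁿ keyNumber i → keyNumber i <ⁿ hi → al (keyNumber i) ≡ true →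
                     search (node ltT k T U) (key i) ≡ key i
        labels-key i l r e = [ (λ i<c → trans (search-yes ltT k T U (lt-key i<c)) (κ i l i<c e))
                             , (λ c≤i → trans (search-no ltT k T U (ge-key c≤i)) (κ′ i c≤i r e)) ]′
                             (compare (keyNumber i) (keyNumber k))
    realize {al} {lo} {hi} (weaken {x = x} {y} x≤y X) hi≤ dead₀ = relax (realize X hi≤ dead₀)
      where
      relax : Realized al lo hi x → Realized al lo hi y
      relax (T , lab , le) = T , lab , ≤-trans le x≤y

-- Passage from finite index sets to ranges, and the theorem

extend : ∀ {m} → (Fin m → ℚ) → ℕ → ℚ
extend {zero}  f j       = 0ℚ
extend {suc m} f zero    = f Fin.zero
extend {suc m} f (suc j) = extend (f ∘ Fin.suc) j

extend-toℕ : ∀ {m} (f : Fin m → ℚ) i → extend f (toℕ i) ≡ f i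
extend-toℕ f Fin.zero    = refl
extend-toℕ f (Fin.suc i) = extend-toℕ (f ∘ Fin.suc) i

extend≥0 : ∀ {m} (f : Fin m → ℚ) → (∀ i → 0ℚ ≤ f i) → ∀ j → 0ℚ ≤ extend f j
extend≥0 {zero}  f h j       = ≤-refl
extend≥0 {suc m} f h zero    = h Fin.zero
extend≥0 {suc m} f h (suc j) = extend≥0 (f ∘ Fin.suc) (h ∘ Fin.suc) j

-- `Σℚ` splits off the first term while `prefix` splits off the last one.
sum-shift : ∀ F m → sum F 0 (suc m) ≡ F 0 + sum (F ∘ suc) 0 m
sum-shift F m = trans (cong (_- 0ℚ) (prefix-shift m))
  (solve 2 (λ x y → (x :+ y) :- con0 := x :+ (y :- con0)) refl (F 0) (prefix (F ∘ suc) m))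
  where
  prefix-shift : ∀ m → prefix F (suc m) ≡ F 0 + prefix (F ∘ suc) m
  prefix-shift zero    = trans (+-identityˡ (F 0)) (sym (+-identityʳ (F 0)))
  prefix-shift (suc m) = trans (cong (_+ F (suc m)) (prefix-shift m)) (+-assoc (F 0) (prefix (F ∘ suc) m) (F (suc m)))

sum-Σℚ : ∀ {m} (F : ℕ → ℚ) (f : Fin m → ℚ) → (∀ i → F (toℕ i) ≡ f i) → sum F 0 m ≡ Σℚ f
sum-Σℚ {zero}  F f h = refl
sum-Σℚ {suc m} F f h = trans (sum-shift F m) (cong₂ _+_ (h Fin.zero) (sum-Σℚ (F ∘ suc) (f ∘ Fin.suc) (h ∘ Fin.suc)))

-- The keys live at the root; brick 0 consists of a gap only.
isKey : ℕ → Bool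
isKey zero    = false
isKey (suc _) = true

keyWeights : ∀ {n} → (Fin n → ℚ) → ℕ → ℚ
keyWeights β zero    = 0ℚ
keyWeights β (suc j) = extend β j

keyWeights≥0 : ∀ {n} (β : Fin n → ℚ) → (∀ i → 0ℚ ≤ β i) → ∀ j → 0ℚ ≤ keyWeights β j
keyWeights≥0 β h zero    = ≤-refl
keyWeights≥0 β h (suc j) = extend≥0 β h j

sum-bricks : ∀ {n} (F G : ℕ → ℚ) (f : Fin (suc n) → ℚ) (g : Fin n → ℚ) →
  (∀ i → F (toℕ i) ≡ f i) → (∀ i → G (suc (toℕ i)) ≡ g i) →
  sum (λ j → F j + (if isKey j then G j else 0ℚ)) 0 (suc n) ≡ Σℚ g + Σℚ f
sum-bricks {n} F G f g hf hg = begin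
  sum (λ j → F j + G₀ j) 0 (suc n)           ≡⟨ sum-+ F G₀ 0 (suc n) ⟩
  sum F 0 (suc n) + sum G₀ 0 (suc n)         ≡⟨ cong₂ _+_ (sum-Σℚ F f hf) (trans (sum-shift G₀ n) (+-identityˡ (sum (G ∘ suc) 0 n))) ⟩
  Σℚ f + sum (G ∘ suc) 0 n                   ≡⟨ cong (Σℚ f +_) (sum-Σℚ (G ∘ suc) g hg) ⟩
  Σℚ f + Σℚ g                                ≡⟨ +-comm (Σℚ f) (Σℚ g) ⟩
  Σℚ g + Σℚ f                                ∎
  where
  open ≡-Reasoning
  G₀ : ℕ → ℚ
  G₀ j = if isKey j then G j else 0ℚ

theorem1 : (n : ℕ) (α : Fin (suc n) → ℚ) (β : Fin n → ℚ) → IsInstance α β →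
    (Tstar : Tree-nil n) → Correct-nil Tstar →
    Σ (Tree-loc n) (λ T′ → Correct-loc T′ × (cost α β T′ ≤ cost α β Tstar + 1ℚ))
theorem1 n α β (α≥0 , β≥0 , total) Tstar correct =
  finish (convert (prune Tstar isKey 0 (suc n) z<s ℕₚ.≤-refl refl ((λ i _ _ → correct (gap i)) , (λ i _ _ _ → correct (key i)))))
  where
  open Weights (extend α) (keyWeights β) (extend≥0 α α≥0) (keyWeights≥0 β β≥0)

  expected-cost : ∀ {L} (T : Tree n L) → expected T isKey 0 (suc n) ≡ cost α β T
  expected-cost T = sum-bricks (λ j → extend α j * ℕ→ℚ (gapDepth T j)) (λ j → keyWeights β j * ℕ→ℚ (keyDepth T j))
    (λ i → α i * ℕ→ℚ (depth T (gap i))) (λ k → β k * ℕ→ℚ (depth T (key k)))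
    (λ i → cong₂ _*_ (extend-toℕ α i) (cong ℕ→ℚ (sym (depth-gap T i))))
    (λ i → cong₂ _*_ (extend-toℕ β i) (cong ℕ→ℚ (sym (depth-key T i))))

  total-weight : weight isKey 0 (suc n) ≡ 1ℚ
  total-weight = trans (sum-bricks (extend α) (keyWeights β) α β (extend-toℕ α) (extend-toℕ β)) (trans (+-comm (Σℚ β) (Σℚ α)) total)

  cover : Cover (const false) isKey 0 (suc n)
  cover (suc j) _ _ ()

  finish : Realized isKey 0 (suc n) (cost α β Tstar + 1ℚ) →
           Σ (Tree-loc n) (λ T′ → Correct-loc T′ × (cost α β T′ ≤ cost α β Tstar + 1ℚ))
  finish (T′ , (g , κ) , le) = T′ , correct′ , ≤-trans (≤-reflexive (sym (expected-cost T′))) le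
    where
    correct′ : Correct-loc T′
    correct′ (key k) = κ k z≤n (s≤s (toℕ<n k)) refl
    correct′ (gap i) = g i z≤n (toℕ<n i)

  convert : Pruned Tstar isKey 0 (suc n) → Realized isKey 0 (suc n) (cost α β Tstar + 1ℚ)
  convert (t , v , le) = realize
    -- The surplus at the root is the total weight, which gives the `1ℚ` in the bound.
    (weaken (≤-trans le (≤-reflexive (expected-cost Tstar)) ⊹ ≤-reflexive total-weight) (locate (size t) ℕₚ.≤-refl v cover))
    ℕₚ.≤-refl refl
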